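{- Let $d\ge2$ and let $i,j$ be nonnegative integers with $j<d-1$ such that either $(i,j)=(0,0)$, or $i\ge1$ and $i+j\le d-1$. Define $$f_d(i,j,x)=\sum_{k=0}^{d-1} C_{d-1-k}(1-x)^kx^{d-k}\sum_{s=0}^{j}\binom{j}{s}\binom{d+i+j-1-k-s}{k-s},\qquad C_n=\tfrac1{n+1}\tbinom{2n}{n}.$$ Then for every $m$, the coefficient of $x^{d-m}$ in $f_d(i,j,x)$ equals the number of noncrossing partitions of $\{1,2,\ldots,d-1\}$ having exactly $m$ elements $v$ with one of the following properties: $v$ is the minimum element of a block with at least two elements; $\{v\}$ is a singleton block and $v\le i$ or $v\ge d-j$; $v\ge d-j$, $v$ is not the minimum element of its block, and if $v$ is the maximum element of its block then that block contains $1$.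
   Context: A partition of $\{1,\ldots,n\}$ is noncrossing if whenever $a<b<c<e$ with $a,c$ in one block and $b,e$ in one block, all four lie in the same block. ($f_d(i,j,x)$ is the contribution of a shelling component of type $(i,j)$ to the toric $f$-polynomial of a shellable $(d-1)$-dimensional cubical complex; the hypotheses describe the possible types with $j<d-1$.) -}

module Defs where

open import Data.Bool using (Bool; true; false; _∧_; _∨_; not; if_then_else_)
open import Data.Nat as ℕ using (ℕ; zero; suc; _∸_; _/_; _≡ᵇ_; _≤ᵇ_; _<ᵇ_)
open import Data.Nat.Combinatorics using (_C_)
open import Data.Integer as ℤ using (ℤ; +_; -[1+_])
open import Data.List using (List; []; _∷_; map; concatMap; foldr; length; upTo)

-- Integer polynomials as coefficient lists (index = power of x)

Poly : Set
Poly = List ℤ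

_⊕_ : Poly → Poly → Poly
[] ⊕ q = q
p ⊕ [] = p
(a ∷ p) ⊕ (b ∷ q) = (a ℤ.+ b) ∷ (p ⊕ q)

scale : ℤ → Poly → Poly
scale c = map (c ℤ.*_)

_⊗_ : Poly → Poly → Poly
[] ⊗ q = []
(a ∷ p) ⊗ q = scale a q ⊕ (+ 0 ∷ (p ⊗ q))

one : Poly
one = + 1 ∷ []

xPow : ℕ → Poly
xPow zero = one
xPow (suc n) = + 0 ∷ xPow n

oneMinusX : Poly
oneMinusX = + 1 ∷ ℤ.- (+ 1) ∷ []

pPow : Poly → ℕ → Poly
pPow p zero = one
pPow p (suc n) = p ⊗ pPow p n

coeff : Poly → ℕ → ℤ
coeff [] n = + 0
coeff (a ∷ p) zero = a
coeff (a ∷ p) (suc n) = coeff p n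

coeffℤ : Poly → ℤ → ℤ
coeffℤ p (+ n) = coeff p n
coeffℤ p -[1+ n ] = + 0

sumTo : ℕ → (ℕ → ℕ) → ℕ
sumTo zero f = f 0
sumTo (suc n) f = sumTo n f ℕ.+ f (suc n)

psumBelow : ℕ → (ℕ → Poly) → Poly
psumBelow zero p = []
psumBelow (suc n) p = psumBelow n p ⊕ p n

catalan : ℕ → ℕ
catalan n = ((2 ℕ.* n) C n) / suc n

-- binomial (a choose b) with b an integer: 0 if b < 0
-- here b = k - s, given as the pair (k , s)
binomDiff : ℕ → ℕ → ℕ → ℕ
binomDiff a k s = if s ≤ᵇ k then a C (k ∸ s) else 0

-- inner sum  Σ_{s=0}^{j} (j choose s) (d+i+j-1-k-s choose k-s)
-- (the top index d+i+j-1-k-s is ≥ 0 for 0 ≤ k ≤ d-1, s ≤ j)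
innerSum : ℕ → ℕ → ℕ → ℕ → ℕ
innerSum d i j k =
  sumTo j (λ s → (j C s) ℕ.* binomDiff (d ℕ.+ i ℕ.+ j ∸ 1 ∸ k ∸ s) k s)

fpoly : ℕ → ℕ → ℕ → Poly
fpoly d i j = psumBelow d (λ k →
  scale (+ (catalan (d ∸ 1 ∸ k) ℕ.* innerSum d i j k))
        (pPow oneMinusX k ⊗ xPow (d ∸ k)))

-- Set partitions of {1,…,n}, encoded by the map  v ↦ min(block of v).
-- A list b = [b₁,…,bₙ] with entries in {1,…,n} encodes a partition iff
-- bᵥ ≤ v and b_{bᵥ} = bᵥ for all v; then u,v are in the same block iff
-- bᵤ = bᵥ.  This is a bijection between such lists and set partitions.

-- b at position v (1-based); 0 outside range
at : List ℕ → ℕ → ℕ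
at [] v = 0
at (x ∷ b) zero = 0
at (x ∷ b) (suc zero) = x
at (x ∷ b) (suc (suc v)) = at b (suc v)

range1 : ℕ → List ℕ
range1 n = map suc (upTo n)

allB : List ℕ → (ℕ → Bool) → Bool
allB xs P = foldr (λ x r → P x ∧ r) true xs

anyB : List ℕ → (ℕ → Bool) → Bool
anyB xs P = foldr (λ x r → P x ∨ r) false xs

countB : {A : Set} → (A → Bool) → List A → ℕ
countB P [] = 0
countB P (x ∷ xs) = if P x then suc (countB P xs) else countB P xs

lists : ℕ → ℕ → List (List ℕ)
lists n zero = [] ∷ []
lists n (suc k) = concatMap (λ x → map (x ∷_) (lists n k)) (range1 n)

isPartition : ℕ → List ℕ → Bool
isPartition n b =
  allB (range1 n) (λ v → (1 ≤ᵇ at b v) ∧ (at b v ≤ᵇ v) ∧ (at b (at b v) ≡ᵇ at b v))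

same : List ℕ → ℕ → ℕ → Bool
same b u v = at b u ≡ᵇ at b v

isNoncrossing : ℕ → List ℕ → Bool
isNoncrossing n b =
  allB (range1 n) λ a → allB (range1 n) λ x → allB (range1 n) λ c → allB (range1 n) λ e →
    not ((a <ᵇ x) ∧ (x <ᵇ c) ∧ (c <ᵇ e) ∧ same b a c ∧ same b x e)
    ∨ (same b a x ∧ same b a c ∧ same b a e)

isMin : List ℕ → ℕ → Bool
isMin b v = at b v ≡ᵇ v

isMax : ℕ → List ℕ → ℕ → Bool
isMax n b v = not (anyB (range1 n) (λ u → (v <ᵇ u) ∧ same b u v))

nonSingleton : ℕ → List ℕ → ℕ → Bool
nonSingleton n b v = anyB (range1 n) (λ u → not (u ≡ᵇ v) ∧ same b u v)

special : ℕ → ℕ → ℕ → List ℕ → ℕ → Bool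
special d i j b v =
  (isMin b v ∧ nonSingleton n b v)
  ∨ (not (nonSingleton n b v) ∧ ((v ≤ᵇ i) ∨ (d ∸ j ≤ᵇ v)))
  ∨ ((d ∸ j ≤ᵇ v) ∧ not (isMin b v) ∧ (not (isMax n b v) ∨ same b 1 v))
  where n = d ∸ 1

countNC : ℕ → ℕ → ℕ → ℕ → ℕ
countNC d i j m = countB
  (λ b → isPartition n b ∧ isNoncrossing n b
         ∧ (countB (special d i j b) (range1 n) ≡ᵇ m))
  (lists n n)
  where n = d ∸ 1

{-# OPTIONS --safe #-}
module Submission where

-- Put y = 1 + z and n = d − 1. Reversing the coefficients turns f_d(i,j,x) into
-- Σ_k C_{n-k} z^k (inner sum), so it suffices to show that Σ_π y^{stat π} has this value for every
-- natural number z. Read from left to right, a noncrossing partition is a Motzkin path: a minimum of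
-- a nonsingleton block is an up step, the maximum of one a down step, and singletons and the remaining
-- elements are two kinds of level step. For i ≥ 1 the block of 1 always contributes y for its minimum;
-- its other elements can then be treated as level steps at height 0, because its maximum carries the
-- same weight as its middle elements. The level steps thus weigh 2 + z, 2 or 2 + 2z in the first
-- i − 1, the middle and the last j positions. Path sums are affine in each level weight, which gives
-- the recursions in i and j that Pascal's rule gives for the closed form. For level weights 2, and for
-- i = j = 0, the path sums are coefficients of c(u + z u²)^r / (1 − u c(u + z u²))^q, c being the
-- Catalan series.

open import Defs
open import Data.Nat
open import Data.Nat.Properties
open import Data.Nat.Combinatorics using (_C_; nCk≡nC[n∸k]; nCk+nC[k+1]≡[n+1]C[k+1])
open import Data.Nat.Combinatorics.Specification using (k>n⇒nCk≡0)
open import Data.Nat.DivMod using (m*n/n≡m)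
open import Data.Nat.Tactic.RingSolver using (solve-∀)
open import Data.Bool using (Bool; true; false; if_then_else_; _∧_; _∨_; not; T)
open import Data.Bool.Properties using (T-∧; T-≡; ∧-zeroʳ)
open import Data.Empty using (⊥; ⊥-elim)
open import Data.List using (List; []; _∷_; map; concatMap; length; upTo; applyUpTo; _++_; replicate)
open import Data.List.Membership.DecPropositional _≟_ using (_∈?_)
open import Data.List.Membership.Propositional using (_∈_; _∉_)
open import Data.List.Properties using (++-assoc; ++-identityʳ; map-++; length-map; length-upTo)
open import Data.List.Relation.Unary.All using (All; []; _∷_)
open import Data.List.Relation.Unary.Any using (here; there)
open import Data.Product using (_×_; _,_; proj₁; proj₂; ∃-syntax)
open import Data.Sum using (_⊎_; inj₁; inj₂)
open import Data.Unit using (tt)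
open import Function using (_∘_)
open import Function.Bundles using (Equivalence)
open import Relation.Binary.Definitions using (tri<; tri≈; tri>)
open import Relation.Binary.PropositionalEquality
open import Relation.Nullary using (Dec; yes; no; does; ¬_)
open import Relation.Nullary.Decidable using (map′; dec-true; dec-false)

-- Powers of the Catalan series and Motzkin paths

-- The substitution y = 1 + z turns the signed factors (1 - x)^k into z^k, so the enumeration takes
-- place in natural numbers without subtraction; signs return only when coefficients are compared.
-- The series c(u + z u²) comes from the closed form: (u + z u²)^m = u^m (1 + z u)^m, so for i = j =
-- 0 the sum over k of C_{n-k} binom(n-k, k) z^k is its coefficient of u^n. Write A for this series
-- and G = A / (1 - u A). Then G = 1 + 2 u G + (1 + z) u² G² is the equation of Motzkin paths with
-- all level weights 2, and A = 1 + u A + (1 + z) u² A G that of paths with level weight 1 at height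
-- 0 and 2 above. The weight of a block maximum is not local: it depends on whether the block
-- contains 1. The bottom stack entry `κ` resolves this. For i ≥ 1 it is the block of 1, kept for
-- ever; for i = j = 0, where a singleton block of 1 weighs 1, it is a dummy.

module _ (z : ℕ) where

  -- With c the Catalan series, cpow r (2 + m) is the coefficient of u^m in c(u + z u²)^r; the two
  -- leading zeros make the recursion c^(r+1) = c^r + (u + z u²) c^(r+2) uniform in m.
  cpow : ℕ → ℕ → ℕ
  cpow r zero = 0
  cpow r (suc zero) = 0
  cpow zero (suc (suc zero)) = 1
  cpow zero (suc (suc (suc m))) = 0
  cpow (suc r) (suc (suc m)) =
    cpow r (suc (suc m)) + cpow (suc (suc r)) (suc m) + z * cpow (suc (suc r)) m

  -- cfrac q r (2 + m) is the coefficient of u^m in c(u + z u²)^r / (1 − u c(u + z u²))^q.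
  cfrac : ℕ → ℕ → ℕ → ℕ
  cfrac zero r m = cpow r m
  cfrac (suc q) r zero = 0
  cfrac (suc q) r (suc m) = cfrac q r (suc m) + cfrac (suc q) (suc r) m

  cfrac-0 : ∀ q r → cfrac q r 0 ≡ 0
  cfrac-0 zero r = refl
  cfrac-0 (suc q) r = refl

  cfrac-1 : ∀ q r → cfrac q r 1 ≡ 0
  cfrac-1 zero r = refl
  cfrac-1 (suc q) r = cong (_+ 0) (cfrac-1 q r)

  -- c (1 − u c) = 1 + z u² c².
  cfrac-rec : ∀ q r m → cfrac q (suc r) (2 + m)
    ≡ cfrac (suc q) r (2 + m) + z * cfrac (suc q) (2 + r) m
  cfrac-rec zero r zero = cong (λ a → cpow r 2 + a + z * 0) (sym (cfrac-1 1 (suc r)))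
  cfrac-rec zero r (suc m) rewrite cfrac-rec zero (suc r) m =
    arith (cpow r (3 + m)) (cfrac 1 (suc r) (2 + m)) z (cfrac 1 (3 + r) m) (cpow (2 + r) (suc m))
    where
    arith : ∀ a b z c e → a + (b + z * c) + z * e ≡ a + b + z * (e + c)
    arith = solve-∀
  cfrac-rec (suc q) r zero
    rewrite cfrac-rec q r zero | cfrac-1 q (2 + r) | cfrac-1 q (1 + r)
          | *-zeroʳ z = refl
  cfrac-rec (suc q) r (suc m)
    rewrite cfrac-rec q r (suc m) | cfrac-rec (suc q) (suc r) m =
    arith (cfrac (suc q) r (3 + m)) z (cfrac (suc q) (2 + r) (suc m))
      (cfrac (2 + q) (suc r) (2 + m)) (cfrac (2 + q) (3 + r) m)
    where
    arith : ∀ a z b c e → a + z * b + (c + z * e) ≡ a + c + z * (b + e)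
    arith = solve-∀

  -- With A = c(u + z u²) and G = A / (1 - u A), this is G = 1 + 2 u G + (1 + z) u² G² multiplied by
  -- A^r / (1 - u A)^q. It follows from `cfrac-rec`, that is, A (1 - u A) = 1 + z u² A². Truncated
  -- subtraction is harmless because entries 0 and 1 vanish.
  cfrac-motzkin : ∀ q r m → cfrac (suc q) (suc r) m
    ≡ suc z * cfrac (2 + q) (2 + r) (m ∸ 2) + 2 * cfrac (suc q) (suc r) (m ∸ 1) + cfrac q r m
  cfrac-motzkin q r zero = sym (trans (cong₂ _+_ (cong (_+ 0) (*-zeroʳ z)) (cfrac-0 q r)) refl)
  cfrac-motzkin q r (suc zero) rewrite cfrac-1 q (suc r) | cfrac-1 q r | *-zeroʳ z = refl
  cfrac-motzkin q r (suc (suc zero)) rewrite cfrac-rec q r 0 | cfrac-1 q (suc r)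
     | cfrac-1 q (2 + r) | *-zeroʳ z = arith (cfrac q r 2)
    where
    arith : ∀ a → a + 0 + 0 + 0 ≡ a
    arith = solve-∀
  cfrac-motzkin q r (suc (suc (suc m)))
    rewrite cfrac-rec q r (suc m) | cfrac-rec (suc q) (suc r) m =
    arith (cfrac q r (3 + m)) (cfrac (suc q) (suc r) (2 + m)) z
      (cfrac (suc q) (2 + r) (suc m)) (cfrac (2 + q) (3 + r) m)
    where
    arith : ∀ a b z c e →
      a + b + z * c + (b + (c + e) + z * e) ≡ suc z * (c + e) + 2 * b + a
    arith = solve-∀

  -- Weighted Motzkin paths from height h to 0: up steps weigh 1 + z, down steps 1, and the level
  -- steps at successive positions have the weights listed.
  motzkin : ℕ → List ℕ → ℕ
  motzkin zero [] = 1
  motzkin (suc h) [] = 0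
  motzkin zero (l ∷ ls) = suc z * motzkin 1 ls + l * motzkin 0 ls
  motzkin (suc h) (l ∷ ls) = suc z * motzkin (2 + h) ls + l * motzkin (suc h) ls + motzkin h ls

  -- Cutting a path at its first visit to each lower height leaves h down steps and h + 1 pieces
  -- with series G, hence u^h G^(h+1). The 2 in the index is the offset of `cfrac`; for h > r the
  -- index falls on the vanishing entries.
  motzkin-replicate : ∀ r h → motzkin h (replicate r 2) ≡ cfrac (suc h) (suc h) (2 + r ∸ h)
  motzkin-replicate zero zero rewrite *-zeroʳ z = refl
  motzkin-replicate zero (suc zero) = sym (cfrac-1 2 2)
  motzkin-replicate zero (suc (suc h)) = sym (trans (cong (cfrac (3 + h) (3 + h)) (0∸n≡0 h)) refl)
  motzkin-replicate (suc r) zero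
    rewrite motzkin-replicate r 1 | motzkin-replicate r 0 =
    sym (trans (cfrac-motzkin 0 0 (3 + r)) (+-identityʳ _))
  motzkin-replicate (suc r) (suc h)
    rewrite motzkin-replicate r (2 + h) | motzkin-replicate r (suc h) | motzkin-replicate r h =
    sym (trans (cfrac-motzkin (suc h) (suc h) (2 + r ∸ h))
      (cong₂ (λ a b → suc z * cfrac (3 + h) (3 + h) a + 2 * cfrac (2 + h) (2 + h) b
                      + cfrac (suc h) (suc h) (2 + r ∸ h))
        (trans (∸-+-assoc (2 + r) h 2) (cong (2 + r ∸_) (+-comm h 2)))
        (trans (∸-+-assoc (2 + r) h 1) (cong (2 + r ∸_) (+-comm h 1)))))

  -- A level step leaves the height unchanged, so the paths that use the surplus weight `a` at this
  -- position become arbitrary paths on the other positions once that step is deleted.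
  motzkin-add : ∀ ks l a ls h → motzkin h (ks ++ (l + a) ∷ ls)
    ≡ motzkin h (ks ++ l ∷ ls) + a * motzkin h (ks ++ ls)
  motzkin-add [] l a ls zero = arith (suc z * motzkin 1 ls) l a (motzkin 0 ls)
    where
    arith : ∀ u l a v → u + (l + a) * v ≡ u + l * v + a * v
    arith = solve-∀
  motzkin-add [] l a ls (suc h) =
    arith (suc z * motzkin (2 + h) ls) l a (motzkin (suc h) ls) (motzkin h ls)
    where
    arith : ∀ u l a v w → u + (l + a) * v + w ≡ u + l * v + w + a * v
    arith = solve-∀
  motzkin-add (k ∷ ks) l a ls zero
    rewrite motzkin-add ks l a ls 1 | motzkin-add ks l a ls 0 =
    arith (suc z) k a (motzkin 1 (ks ++ l ∷ ls)) (motzkin 1 (ks ++ ls))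
      (motzkin 0 (ks ++ l ∷ ls)) (motzkin 0 (ks ++ ls))
    where
    arith : ∀ y k a u v w x →
      y * (u + a * v) + k * (w + a * x) ≡ y * u + k * w + a * (y * v + k * x)
    arith = solve-∀
  motzkin-add (k ∷ ks) l a ls (suc h)
    rewrite motzkin-add ks l a ls (2 + h) | motzkin-add ks l a ls (suc h)
          | motzkin-add ks l a ls h =
    arith (suc z) k a (motzkin (2 + h) (ks ++ l ∷ ls)) (motzkin (2 + h) (ks ++ ls))
      (motzkin (suc h) (ks ++ l ∷ ls)) (motzkin (suc h) (ks ++ ls))
      (motzkin h (ks ++ l ∷ ls)) (motzkin h (ks ++ ls))
    where
    arith : ∀ y k a u v w x s t →
      y * (u + a * v) + k * (w + a * x) + (s + a * t)
        ≡ y * u + k * w + s + a * (y * v + k * x + t)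
    arith = solve-∀

  levels : ℕ → ℕ → ℕ → List ℕ
  levels a q b = replicate a (2 + z) ++ replicate q 2 ++ replicate b (2 + (z + z))

  replicate-snoc : ∀ n (x : ℕ) xs → replicate n x ++ x ∷ xs ≡ replicate (suc n) x ++ xs
  replicate-snoc zero x xs = refl
  replicate-snoc (suc n) x xs = cong (x ∷_) (replicate-snoc n x xs)

  -- The step at the border to the middle group is split as 2 plus `z`: the part 2 joins the middle
  -- group, the part `z` deletes the step. Splitting at the border keeps the list of the form
  -- `levels`.
  motzkin-levelsˡ : ∀ a q b → motzkin 0 (levels (suc a) q b)
    ≡ motzkin 0 (levels a (suc q) b) + z * motzkin 0 (levels a q b)
  motzkin-levelsˡ a q b =
    trans (cong (motzkin 0) (sym (replicate-snoc a (2 + z) _)))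
          (motzkin-add (replicate a (2 + z)) 2 z _ 0)

  motzkin-levelsʳ : ∀ a q b → motzkin 0 (levels a q (suc b))
    ≡ motzkin 0 (levels a (suc q) b) + (z + z) * motzkin 0 (levels a q b)
  motzkin-levelsʳ a q b = begin
    motzkin 0 (as ++ qs ++ (2 + (z + z)) ∷ bs)
      ≡⟨ cong (motzkin 0) (sym (++-assoc as qs _)) ⟩
    motzkin 0 ((as ++ qs) ++ (2 + (z + z)) ∷ bs)
      ≡⟨ motzkin-add (as ++ qs) 2 (z + z) bs 0 ⟩
    motzkin 0 ((as ++ qs) ++ 2 ∷ bs) + (z + z) * motzkin 0 ((as ++ qs) ++ bs)
      ≡⟨ cong₂ (λ u v → motzkin 0 u + (z + z) * motzkin 0 v)
           (trans (++-assoc as qs _) (cong (as ++_) (replicate-snoc q 2 bs)))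
           (++-assoc as qs bs) ⟩
    motzkin 0 (levels a (suc q) b) + (z + z) * motzkin 0 (levels a q b) ∎
    where
    open ≡-Reasoning
    as = replicate a (2 + z)
    qs = replicate q 2
    bs = replicate b (2 + (z + z))

  -- In series, (1 + z) u G = A - 1 + z u A. The right-hand side has the shape that one step of the
  -- recursion in i produces from i = j = 0.
  motzkin-base : ∀ q → suc z * motzkin 0 (levels 0 q 0) ≡ cpow 1 (3 + q) + z * cpow 1 (2 + q)
  motzkin-base q = begin
    suc z * motzkin 0 (replicate q 2 ++ [])
      ≡⟨ cong (λ u → suc z * motzkin 0 u) (++-identityʳ (replicate q 2)) ⟩
    suc z * motzkin 0 (replicate q 2)
      ≡⟨ cong (suc z *_) (motzkin-replicate q 0) ⟩
    suc z * (cpow 1 (2 + q) + cfrac 1 2 (1 + q))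
      ≡⟨ arith z (cpow 1 (2 + q)) (cfrac 1 2 (1 + q)) ⟩
    cpow 1 (2 + q) + cfrac 1 2 (1 + q) + z * cfrac 1 2 (1 + q) + z * cpow 1 (2 + q)
      ≡⟨ cong (_+ z * cpow 1 (2 + q)) (sym (cfrac-rec 0 0 (suc q))) ⟩
    cpow 1 (3 + q) + z * cpow 1 (2 + q) ∎
    where
    open ≡-Reasoning
    arith : ∀ z a b → suc z * (a + b) ≡ a + b + z * b + z * a
    arith = solve-∀

-- The closed form

sumTo-cong : ∀ n {f g : ℕ → ℕ} → (∀ k → k ≤ n → f k ≡ g k) → sumTo n f ≡ sumTo n g
sumTo-cong zero f≗g = f≗g 0 z≤n
sumTo-cong (suc n) f≗g =
  cong₂ _+_ (sumTo-cong n (λ k k≤n → f≗g k (m≤n⇒m≤1+n k≤n))) (f≗g (suc n) ≤-refl)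

sumTo-head : ∀ n f → sumTo (suc n) f ≡ f 0 + sumTo n (λ k → f (suc k))
sumTo-head zero f = refl
sumTo-head (suc n) f rewrite sumTo-head n f = +-assoc (f 0) _ _

sumTo-+ : ∀ n f g → sumTo n (λ k → f k + g k) ≡ sumTo n f + sumTo n g
sumTo-+ zero f g = refl
sumTo-+ (suc n) f g rewrite sumTo-+ n f g =
  arith (sumTo n f) (sumTo n g) (f (suc n)) (g (suc n))
  where
  arith : ∀ a b c e → a + b + (c + e) ≡ a + c + (b + e)
  arith = solve-∀

sumTo-* : ∀ n c f → sumTo n (λ k → c * f k) ≡ c * sumTo n f
sumTo-* zero c f = refl
sumTo-* (suc n) c f rewrite sumTo-* n c f = sym (*-distribˡ-+ c _ _)

nC0≡1 : ∀ n → n C 0 ≡ 1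
nC0≡1 zero = refl
nC0≡1 (suc n) = refl

sumTo-pascal : ∀ j (f : ℕ → ℕ) → sumTo (suc j) (λ s → (suc j C s) * f s)
  ≡ sumTo j (λ s → (j C s) * f s) + sumTo j (λ s → (j C s) * f (suc s))
sumTo-pascal j f = begin
  sumTo (suc j) (λ s → (suc j C s) * f s)
    ≡⟨ sumTo-head j (λ s → (suc j C s) * f s) ⟩
  (suc j C 0) * f 0 + sumTo j (λ s → (suc j C suc s) * f (suc s))
    ≡⟨ cong₂ _+_ (cong (_* f 0) (trans (nC0≡1 (suc j)) (sym (nC0≡1 j))))
        (trans (sumTo-cong j (λ s _ → trans
            (cong (_* f (suc s)) (sym (nCk+nC[k+1]≡[n+1]C[k+1] j s)))
            (arith (j C s) (j C suc s) (f (suc s)))))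
          (sumTo-+ j (λ s → (j C suc s) * f (suc s)) (λ s → (j C s) * f (suc s)))) ⟩
  (j C 0) * f 0 + (sumTo j (λ s → (j C suc s) * f (suc s)) + sumTo j (λ s → (j C s) * f (suc s)))
    ≡⟨ sym (+-assoc ((j C 0) * f 0) _ _) ⟩
  (j C 0) * f 0 + sumTo j (λ s → (j C suc s) * f (suc s)) + sumTo j (λ s → (j C s) * f (suc s))
    ≡⟨ cong (_+ sumTo j (λ s → (j C s) * f (suc s)))
         (trans (sym (sumTo-head j (λ s → (j C s) * f s)))
           (trans (cong (λ c → sumTo j (λ s → (j C s) * f s) + c * f (suc j)) (k>n⇒nCk≡0 (n<1+n j)))
                  (+-identityʳ _))) ⟩
  sumTo j (λ s → (j C s) * f s) + sumTo j (λ s → (j C s) * f (suc s)) ∎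
  where
  open ≡-Reasoning
  arith : ∀ a b c → (a + b) * c ≡ b * c + a * c
  arith = solve-∀

-- The sum over m + k = n, written without subtraction. It peels at k = 0 by definition and at m = 0
-- by `antisum-last`, so recursions in either index become recursions in n.
antisum : ℕ → (ℕ → ℕ → ℕ) → ℕ
antisum zero f = f 0 0
antisum (suc n) f = f (suc n) 0 + antisum n (λ m k → f m (suc k))

antisum-cong : ∀ n {f g : ℕ → ℕ → ℕ} → (∀ m k → f m k ≡ g m k) → antisum n f ≡ antisum n g
antisum-cong zero f≗g = f≗g 0 0
antisum-cong (suc n) f≗g =
  cong₂ _+_ (f≗g (suc n) 0) (antisum-cong n (λ m k → f≗g m (suc k)))

antisum-+ : ∀ n f g → antisum n (λ m k → f m k + g m k) ≡ antisum n f + antisum n g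
antisum-+ zero f g = refl
antisum-+ (suc n) f g rewrite antisum-+ n (λ m k → f m (suc k)) (λ m k → g m (suc k)) =
  arith (f (suc n) 0) (g (suc n) 0) (antisum n (λ m k → f m (suc k))) (antisum n (λ m k → g m (suc k)))
  where
  arith : ∀ a b c e → a + b + (c + e) ≡ a + c + (b + e)
  arith = solve-∀

antisum-* : ∀ n c f → antisum n (λ m k → c * f m k) ≡ c * antisum n f
antisum-* zero c f = refl
antisum-* (suc n) c f rewrite antisum-* n c (λ m k → f m (suc k)) = sym (*-distribˡ-+ c _ _)

antisum-last : ∀ n f → antisum (suc n) f ≡ antisum n (λ m k → f (suc m) k) + f 0 (suc n)
antisum-last zero f = refl
antisum-last (suc n) f rewrite antisum-last n (λ m k → f m (suc k)) =
  sym (+-assoc (f (2 + n) 0) _ _)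

sumTo≡antisum : ∀ n f → sumTo n (λ k → f (n ∸ k) k) ≡ antisum n f
sumTo≡antisum zero f = refl
sumTo≡antisum (suc n) f = begin
  sumTo n (λ k → f (suc n ∸ k) k) + f (n ∸ n) (suc n)
    ≡⟨ cong₂ _+_ (sumTo-cong n (λ k k≤n → cong (λ m → f m k) (+-∸-assoc 1 k≤n)))
                 (cong (λ m → f m (suc n)) (n∸n≡0 n)) ⟩
  sumTo n (λ k → f (suc (n ∸ k)) k) + f 0 (suc n)
    ≡⟨ cong (_+ f 0 (suc n)) (sumTo≡antisum n (λ m k → f (suc m) k)) ⟩
  antisum n (λ m k → f (suc m) k) + f 0 (suc n)
    ≡⟨ sym (antisum-last n f) ⟩
  antisum (suc n) f ∎
  where open ≡-Reasoning

-- The coefficient of x^m in the r-th power of the Catalan series.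
ballot : ℕ → ℕ → ℕ
ballot r zero = 1
ballot zero (suc m) = 0
ballot (suc r) (suc m) = ballot r (suc m) + ballot (2 + r) m

-- The identity (k + 1) binom(n, k + 1) = (n - k) binom(n, k) with the subtraction moved to the
-- left.
C-absorb : ∀ n k → suc k * (n C suc k) + k * (n C k) ≡ n * (n C k)
C-absorb zero zero = refl
C-absorb zero (suc k)
  rewrite k>n⇒nCk≡0 {0} {suc k} z<s | k>n⇒nCk≡0 {0} {2 + k} z<s | *-zeroʳ k = refl
C-absorb (suc n) zero
  rewrite sym (nCk+nC[k+1]≡[n+1]C[k+1] n 0) | nC0≡1 (suc n) | nC0≡1 n =
  trans (arith (n C 1)) (cong suc (trans (C-absorb n 0) (cong (n *_) (nC0≡1 n))))
  where
  arith : ∀ a → 1 * (1 + a) + 0 ≡ suc (1 * a + 0)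
  arith = solve-∀
C-absorb (suc n) (suc k)
  rewrite sym (nCk+nC[k+1]≡[n+1]C[k+1] n (suc k)) | sym (nCk+nC[k+1]≡[n+1]C[k+1] n k) = begin
  (2 + k) * (b + c) + suc k * (a + b)
    ≡⟨ arith₁ k a b c ⟩
  ((2 + k) * c + suc k * b) + (suc k * b + k * a) + (a + b)
    ≡⟨ cong (_+ (a + b)) (cong₂ _+_ (C-absorb n (suc k)) (C-absorb n k)) ⟩
  n * b + n * a + (a + b)
    ≡⟨ arith₂ n a b ⟩
  suc n * (a + b) ∎
  where
  open ≡-Reasoning
  a = n C k
  b = n C suc k
  c = n C (2 + k)
  arith₁ : ∀ k a b c → (2 + k) * (b + c) + suc k * (a + b)
    ≡ ((2 + k) * c + suc k * b) + (suc k * b + k * a) + (a + b)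
  arith₁ = solve-∀
  arith₂ : ∀ n a b → n * b + n * a + (a + b) ≡ suc n * (a + b)
  arith₂ = solve-∀

-- The reflection principle, with the subtracted binomial coefficient moved to the left.
ballot-binomial : ∀ r m → ballot r (suc m) + suc (m + m + r) C m ≡ suc (m + m + r) C suc m
ballot-binomial zero m rewrite +-identityʳ (m + m) =
  trans (nCk≡nC[n∸k] (m≤n⇒m≤1+n (m≤m+n m m)))
        (cong (suc (m + m) C_) (trans (+-∸-assoc 1 (m≤m+n m m)) (cong suc (m+n∸m≡n m m))))
ballot-binomial (suc r) zero = begin
  ballot r 1 + 1 + (2 + r) C 0
    ≡⟨ cong (ballot r 1 + 1 +_) (nC0≡1 (2 + r)) ⟩
  ballot r 1 + 1 + 1
    ≡⟨ cong₂ _+_ (trans (cong (ballot r 1 +_) (sym (nC0≡1 (suc r)))) (ballot-binomial r 0))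
                 (sym (nC0≡1 (suc r))) ⟩
  suc r C 1 + suc r C 0
    ≡⟨ trans (+-comm (suc r C 1) _) (nCk+nC[k+1]≡[n+1]C[k+1] (suc r) 0) ⟩
  (2 + r) C 1 ∎
  where open ≡-Reasoning
ballot-binomial (suc r) (suc m) = begin
  p + q + suc (suc m + suc m + suc r) C suc m
    ≡⟨ cong (λ N → p + q + suc N C suc m) shift ⟩
  p + q + suc n C suc m
    ≡⟨ cong (p + q +_) (sym (nCk+nC[k+1]≡[n+1]C[k+1] n m)) ⟩
  p + q + (n C m + n C suc m)
    ≡⟨ arith p q (n C m) (n C suc m) ⟩
  (q + n C m) + (p + n C suc m)
    ≡⟨ cong₂ _+_
         (subst (λ N → q + N C m ≡ N C suc m) shift′ (ballot-binomial (2 + r) m))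
         (ballot-binomial r (suc m)) ⟩
  n C suc m + n C (2 + m)
    ≡⟨ nCk+nC[k+1]≡[n+1]C[k+1] n (suc m) ⟩
  suc n C (2 + m)
    ≡⟨ cong (λ N → suc N C (2 + m)) (sym shift) ⟩
  suc (suc m + suc m + suc r) C (2 + m) ∎
  where
  open ≡-Reasoning
  n = suc (suc m + suc m + r)
  p = ballot r (2 + m)
  q = ballot (2 + r) (suc m)
  shift : suc m + suc m + suc r ≡ n
  shift = +-suc (suc m + suc m) r
  shift′ : suc (m + m + (2 + r)) ≡ n
  shift′ = arith′ m r
    where
    arith′ : ∀ m r → suc (m + m + (2 + r)) ≡ suc (suc m + suc m + r)
    arith′ = solve-∀
  arith : ∀ p q a b → p + q + (a + b) ≡ (q + a) + (p + b)
  arith = solve-∀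

ballot≡catalan : ∀ m → ballot 1 m ≡ catalan m
ballot≡catalan zero = refl
ballot≡catalan (suc m) = begin
  ballot 1 (suc m)
    ≡⟨ sym (m*n/n≡m (ballot 1 (suc m)) (2 + m)) ⟩
  (ballot 1 (suc m) * (2 + m)) / (2 + m)
    ≡⟨ cong (_/ (2 + m)) main ⟩
  (n C suc m) / (2 + m)
    ≡⟨ cong (λ N → (N C suc m) / (2 + m)) (arith₀ m) ⟩
  catalan (suc m) ∎
  where
  open ≡-Reasoning
  n = suc (m + m + 1)
  arith₀ : ∀ m → suc (m + m + 1) ≡ 2 * suc m
  arith₀ = solve-∀
  arith₁ : ∀ m a b → a * (2 + m) + ((2 + m) * b + m * b) ≡ (a + b) * (2 + m) + m * b
  arith₁ = solve-∀
  arith₂ : ∀ m a b → a * (2 + m) + m * b ≡ a + (suc m * a + m * b)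
  arith₂ = solve-∀
  arith₃ : ∀ m b → suc (m + m + 1) * b ≡ (2 + m) * b + m * b
  arith₃ = solve-∀
  main : ballot 1 (suc m) * (2 + m) ≡ n C suc m
  -- The ballot number is a difference of binomial coefficients. Adding `n * (n C m)`, which is (m +
  -- 2) + m copies of `n C m` as n = 2 m + 2, allows `ballot-binomial` and `C-absorb` to be applied
  -- without subtraction.
  main = +-cancelʳ-≡ (n * (n C m)) _ _ (begin
    ballot 1 (suc m) * (2 + m) + n * (n C m)
      ≡⟨ cong (ballot 1 (suc m) * (2 + m) +_) (arith₃ m (n C m)) ⟩
    ballot 1 (suc m) * (2 + m) + ((2 + m) * (n C m) + m * (n C m))
      ≡⟨ arith₁ m (ballot 1 (suc m)) (n C m) ⟩
    (ballot 1 (suc m) + n C m) * (2 + m) + m * (n C m)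
      ≡⟨ cong (λ a → a * (2 + m) + m * (n C m)) (ballot-binomial 1 m) ⟩
    (n C suc m) * (2 + m) + m * (n C m)
      ≡⟨ arith₂ m (n C suc m) (n C m) ⟩
    n C suc m + (suc m * (n C suc m) + m * (n C m))
      ≡⟨ cong (n C suc m +_) (C-absorb n m) ⟩
    n C suc m + n * (n C m) ∎)

-- The inner sum of the paper's formula, with M = d − 1 + i − k.
innerCoeff : ℕ → ℕ → ℕ → ℕ
innerCoeff M zero k = M C k
innerCoeff M (suc j) zero = 1
innerCoeff M (suc j) (suc k) = innerCoeff (suc M) j (suc k) + innerCoeff M j k

innerCoeff-0 : ∀ M j → innerCoeff M j 0 ≡ 1
innerCoeff-0 M zero = nC0≡1 M
innerCoeff-0 M (suc j) = refl

-- As polynomials in x, the sum over k of `innerCoeff M j k` x^k is (1 + x)^M (1 + 2 x)^j. This is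
-- its factor 1 + x; the factor 1 + 2 x then results from the defining recursion.
innerCoeff-pascal : ∀ M j k → innerCoeff (suc M) j (suc k) ≡ innerCoeff M j (suc k) + innerCoeff M j k
innerCoeff-pascal M zero k = trans (sym (nCk+nC[k+1]≡[n+1]C[k+1] M k)) (+-comm (M C k) _)
innerCoeff-pascal M (suc j) zero
  rewrite innerCoeff-pascal (suc M) j 0 | innerCoeff-0 (suc M) j | innerCoeff-0 M j = refl
innerCoeff-pascal M (suc j) (suc k)
  rewrite innerCoeff-pascal (suc M) j (suc k) | innerCoeff-pascal M j k =
  arith (innerCoeff (suc M) j (suc (suc k))) (innerCoeff M j (suc k)) (innerCoeff M j k)
  where
  arith : ∀ a b c → a + (b + c) + (b + c) ≡ a + b + (b + c + c)
  arith = solve-∀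

binomDiff-suc : ∀ a k s → binomDiff a (suc k) (suc s) ≡ binomDiff a k s
binomDiff-suc a k zero = refl
binomDiff-suc a k (suc s) = refl

-- Pascal's rule for `j C s` splits the sum into one with M + 1 in place of M and one with k lowered
-- by 1, which is the defining recursion of `innerCoeff`.
innerCoeff-sum : ∀ M j k → sumTo j (λ s → (j C s) * binomDiff (M + j ∸ s) k s) ≡ innerCoeff M j k
innerCoeff-sum M zero k = trans (*-identityˡ _) (cong (_C k) (+-identityʳ M))
innerCoeff-sum M (suc j) k = trans (sumTo-pascal j (λ s → binomDiff (M + suc j ∸ s) k s)) (step k)
  where
  first : ∀ k → sumTo j (λ s → (j C s) * binomDiff (M + suc j ∸ s) k s) ≡ innerCoeff (suc M) j k
  first k = trans
    (sumTo-cong j (λ s _ → cong (λ a → (j C s) * binomDiff (a ∸ s) k s) (+-suc M j)))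
    (innerCoeff-sum (suc M) j k)
  step : ∀ k → sumTo j (λ s → (j C s) * binomDiff (M + suc j ∸ s) k s)
    + sumTo j (λ s → (j C s) * binomDiff (M + suc j ∸ suc s) k (suc s)) ≡ innerCoeff M (suc j) k
  step zero = cong₂ _+_ (trans (first 0) (innerCoeff-0 (suc M) j))
    (trans (sumTo-cong j (λ s _ → *-zeroʳ (j C s))) (sumTo-* j 0 (λ _ → 0)))
  step (suc k) = cong₂ _+_ (first (suc k))
    (trans (sumTo-cong j (λ s _ → cong ((j C s) *_)
        (trans (cong (λ a → binomDiff (a ∸ suc s) (suc k) (suc s)) (+-suc M j))
               (binomDiff-suc (M + j ∸ s) k s))))
      (innerCoeff-sum M j k))

module _ (z : ℕ) where

  term : ℕ → ℕ → ℕ → ℕ → ℕ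
  term i j m k = catalan m * innerCoeff (m + i) j k * z ^ k

  -- Σ_k C_{n-k} z^k (inner sum), where n = d − 1.
  closed : ℕ → ℕ → ℕ → ℕ
  closed n i j = antisum n (term i j)

  -- With m = n - k held fixed, the argument m + i of `innerCoeff` does not move when k drops by 1,
  -- so a recursion in k becomes one in n with factor `z`. The terms with k = 0 agree because
  -- `innerCoeff` is 1 there. Raising i takes c = 1 and raising j takes c = 2, from the factors 1 +
  -- x and 1 + 2 x.
  closed-rec : ∀ n i j i′ j′ c →
    (∀ m k → innerCoeff (m + i′) j′ (suc k) ≡ innerCoeff (m + i) j (suc k) + c * innerCoeff (m + i) j k)
    → closed (suc n) i′ j′ ≡ closed (suc n) i j + c * z * closed n i j
  closed-rec n i j i′ j′ c rec = begin
    term i′ j′ (suc n) 0 + antisum n (λ m k → term i′ j′ m (suc k))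
      ≡⟨ cong₂ _+_ (cong (λ a → catalan (suc n) * a * 1)
             (trans (innerCoeff-0 (suc n + i′) j′) (sym (innerCoeff-0 (suc n + i) j))))
           (trans (antisum-cong n (λ m k → trans
               (cong (λ a → catalan m * a * z ^ suc k) (rec m k))
               (arith (catalan m) (innerCoeff (m + i) j (suc k)) c (innerCoeff (m + i) j k) z (z ^ k))))
             (trans (antisum-+ n (λ m k → term i j m (suc k)) (λ m k → c * z * term i j m k))
               (cong (antisum n (λ m k → term i j m (suc k)) +_) (antisum-* n (c * z) (term i j))))) ⟩
    term i j (suc n) 0 + (antisum n (λ m k → term i j m (suc k)) + c * z * closed n i j)
      ≡⟨ sym (+-assoc (term i j (suc n) 0) _ _) ⟩
    closed (suc n) i j + c * z * closed n i j ∎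
    where
    open ≡-Reasoning
    arith : ∀ x a c b z w → x * (a + c * b) * (z * w) ≡ x * a * (z * w) + c * z * (x * b * w)
    arith = solve-∀

  closed-suc-i : ∀ n i j → closed (suc n) (suc i) j ≡ closed (suc n) i j + z * closed n i j
  closed-suc-i n i j = trans
    (closed-rec n i j (suc i) j 1 λ m k → trans (cong (λ a → innerCoeff a j (suc k)) (+-suc m i))
      (trans (innerCoeff-pascal (m + i) j k) (cong (innerCoeff (m + i) j (suc k) +_) (sym (*-identityˡ _)))))
    (cong (λ w → closed (suc n) i j + w * closed n i j) (*-identityˡ z))

  closed-suc-j : ∀ n i j → closed (suc n) i (suc j) ≡ closed (suc n) i j + (z + z) * closed n i j
  closed-suc-j n i j = trans
    (closed-rec n i j i (suc j) 2 λ m k →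
      trans (cong (_+ innerCoeff (m + i) j k) (innerCoeff-pascal (m + i) j k))
            (arith (innerCoeff (m + i) j (suc k)) (innerCoeff (m + i) j k)))
    (cong (λ w → closed (suc n) i j + (z + w) * closed n i j) (+-identityʳ z))
    where
    arith : ∀ a b → a + b + b ≡ a + 2 * b
    arith = solve-∀

  -- The coefficient of u^n in c(u + z u²)^r, since (u + z u²)^m = u^m (1 + z u)^m.
  ballotsum : ℕ → ℕ → ℕ
  ballotsum r n = antisum n (λ m k → ballot r m * (m C k) * z ^ k)

  -- The factor (1 + z u)^(m+1) is written as (1 + z u) (1 + z u)^m.
  pascal-shift : ∀ (β : ℕ → ℕ) n → antisum (suc n) (λ m k → β m * (suc m C k) * z ^ k)
    ≡ antisum (suc n) (λ m k → β m * (m C k) * z ^ k)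
      + z * antisum n (λ m k → β m * (m C k) * z ^ k)
  pascal-shift β n = begin
    β (suc n) * 1 * 1 + antisum n (λ m k → β m * (suc m C suc k) * z ^ suc k)
      ≡⟨ cong (β (suc n) * 1 * 1 +_) (trans (antisum-cong n (λ m k → trans
           (cong (λ a → β m * a * z ^ suc k) (sym (nCk+nC[k+1]≡[n+1]C[k+1] m k)))
           (arith (β m) (m C k) (m C suc k) z (z ^ k))))
         (trans (antisum-+ n (λ m k → β m * (m C suc k) * z ^ suc k) (λ m k → z * (β m * (m C k) * z ^ k)))
           (cong (antisum n (λ m k → β m * (m C suc k) * z ^ suc k) +_)
             (antisum-* n z (λ m k → β m * (m C k) * z ^ k))))) ⟩
    β (suc n) * 1 * 1 + (antisum n (λ m k → β m * (m C suc k) * z ^ suc k)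
      + z * antisum n (λ m k → β m * (m C k) * z ^ k))
      ≡⟨ sym (+-assoc (β (suc n) * 1 * 1) _ _) ⟩
    antisum (suc n) (λ m k → β m * (m C k) * z ^ k)
      + z * antisum n (λ m k → β m * (m C k) * z ^ k) ∎
    where
    open ≡-Reasoning
    arith : ∀ b a c z w → b * (a + c) * (z * w) ≡ b * c * (z * w) + z * (b * a * w)
    arith = solve-∀

  -- The recursion c^(r+1) = c^r + x c^(r+2) at x = u (1 + z u). `antisum-last` isolates m = 0,
  -- where every `ballot` value is 1. The factor u lowers n, and the factor 1 + z u raises the upper
  -- binomial index to `suc m`.
  ballotsum-peel : ∀ r n → ballotsum (suc r) (suc n)
    ≡ ballotsum r (suc n) + antisum n (λ m k → ballot (2 + r) m * (suc m C k) * z ^ k)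
  ballotsum-peel r n = begin
    antisum (suc n) (λ m k → ballot (suc r) m * (m C k) * z ^ k)
      ≡⟨ antisum-last n (λ m k → ballot (suc r) m * (m C k) * z ^ k) ⟩
    antisum n (λ m k → ballot (suc r) (suc m) * (suc m C k) * z ^ k) + x
      ≡⟨ cong (_+ x) (trans (antisum-cong n (λ m k →
            arith (ballot r (suc m)) (ballot (2 + r) m) (suc m C k) (z ^ k)))
          (antisum-+ n (λ m k → ballot r (suc m) * (suc m C k) * z ^ k)
                       (λ m k → ballot (2 + r) m * (suc m C k) * z ^ k))) ⟩
    u + v + x
      ≡⟨ arith′ u v x ⟩
    u + x + v
      ≡⟨ cong (_+ v) (sym (antisum-last n (λ m k → ballot r m * (m C k) * z ^ k))) ⟩
    ballotsum r (suc n) + v ∎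
    where
    open ≡-Reasoning
    x = 1 * (0 C suc n) * z ^ suc n
    u = antisum n (λ m k → ballot r (suc m) * (suc m C k) * z ^ k)
    v = antisum n (λ m k → ballot (2 + r) m * (suc m C k) * z ^ k)
    arith : ∀ a b c w → (a + b) * c * w ≡ a * c * w + b * c * w
    arith = solve-∀
    arith′ : ∀ a b c → a + b + c ≡ a + c + b
    arith′ = solve-∀

  ballotsum-0 : ∀ n → ballotsum 0 (suc n) ≡ 0
  ballotsum-0 n = trans (antisum-last n (λ m k → ballot 0 m * (m C k) * z ^ k))
    (cong₂ _+_ (antisum-* n 0 (λ _ _ → 0))
               (cong (λ a → 1 * a * z ^ suc n) (k>n⇒nCk≡0 {0} {suc n} z<s)))

  ballotsum≡cpow : ∀ r n → ballotsum r n ≡ cpow z r (2 + n)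
  ballotsum≡cpow zero zero = refl
  ballotsum≡cpow zero (suc n) = ballotsum-0 n
  ballotsum≡cpow (suc r) zero = trans (ballotsum≡cpow r zero)
    (sym (trans (cong (cpow z r 2 + 0 +_) (*-zeroʳ z)) (trans (+-identityʳ _) (+-identityʳ _))))
  ballotsum≡cpow (suc r) (suc zero) = trans (ballotsum-peel r 0) (trans
    (cong₂ _+_ (ballotsum≡cpow r (suc zero)) (ballotsum≡cpow (suc (suc r)) zero))
    (sym (trans (cong (cpow z r 3 + cpow z (2 + r) 2 +_) (*-zeroʳ z)) (+-identityʳ _))))
  ballotsum≡cpow (suc r) (suc (suc n)) = trans (ballotsum-peel r (suc n)) (trans
    (cong₂ _+_ (ballotsum≡cpow r (suc (suc n))) (trans (pascal-shift (ballot (2 + r)) n)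
      (cong₂ (λ a b → a + z * b) (ballotsum≡cpow (suc (suc r)) (suc n)) (ballotsum≡cpow (suc (suc r)) n))))
    (sym (+-assoc (cpow z r (4 + n)) _ _)))

  closed-00 : ∀ n → closed n 0 0 ≡ cpow z 1 (2 + n)
  closed-00 n = trans
    (antisum-cong n (λ m k → cong₂ (λ a b → a * (b C k) * z ^ k)
       (sym (ballot≡catalan m)) (+-identityʳ m)))
    (ballotsum≡cpow 1 n)

  -- Both sides obey the same recursions in a and b. Each turns a special level step into a middle
  -- one or deletes it, so `q` has to stay arbitrary in the induction. Position 1 carries the factor
  -- `suc z` instead of a level step, hence n = 1 + a + q + b and i = 1 + a.
  levels-closed : ∀ b a q → suc z * motzkin z 0 (levels z a q b) ≡ closed (suc (a + q + b)) (suc a) b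
  levels-closed zero zero q = begin
    suc z * motzkin z 0 (levels z 0 q 0)
      ≡⟨ motzkin-base z q ⟩
    cpow z 1 (3 + q) + z * cpow z 1 (2 + q)
      ≡⟨ cong₂ (λ u v → u + z * v) (sym (closed-00 (suc q))) (sym (closed-00 q)) ⟩
    closed (suc q) 0 0 + z * closed q 0 0
      ≡⟨ sym (closed-suc-i q 0 0) ⟩
    closed (suc q) 1 0
      ≡⟨ cong (λ n → closed (suc n) 1 0) (sym (+-identityʳ q)) ⟩
    closed (suc (q + 0)) 1 0 ∎
    where open ≡-Reasoning
  levels-closed zero (suc a) q = begin
    suc z * motzkin z 0 (levels z (suc a) q 0)
      ≡⟨ cong (suc z *_) (motzkin-levelsˡ z a q 0) ⟩
    suc z * (motzkin z 0 (levels z a (suc q) 0) + z * motzkin z 0 (levels z a q 0))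
      ≡⟨ distrib (suc z) z _ _ ⟩
    suc z * motzkin z 0 (levels z a (suc q) 0) + z * (suc z * motzkin z 0 (levels z a q 0))
      ≡⟨ cong₂ (λ u v → u + z * v) (levels-closed zero a (suc q)) (levels-closed zero a q) ⟩
    closed (suc (a + suc q + 0)) (suc a) 0 + z * closed (suc (a + q + 0)) (suc a) 0
      ≡⟨ cong (λ n → closed (suc n) (suc a) 0 + z * closed (suc (a + q + 0)) (suc a) 0)
              (cong (_+ 0) (+-suc a q)) ⟩
    closed (2 + (a + q + 0)) (suc a) 0 + z * closed (suc (a + q + 0)) (suc a) 0
      ≡⟨ sym (closed-suc-i (suc (a + q + 0)) (suc a) 0) ⟩
    closed (2 + (a + q + 0)) (2 + a) 0 ∎
    where
    open ≡-Reasoning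
    distrib : ∀ y w u v → y * (u + w * v) ≡ y * u + w * (y * v)
    distrib = solve-∀
  levels-closed (suc b) a q = begin
    suc z * motzkin z 0 (levels z a q (suc b))
      ≡⟨ cong (suc z *_) (motzkin-levelsʳ z a q b) ⟩
    suc z * (motzkin z 0 (levels z a (suc q) b) + (z + z) * motzkin z 0 (levels z a q b))
      ≡⟨ distrib (suc z) (z + z) _ _ ⟩
    suc z * motzkin z 0 (levels z a (suc q) b) + (z + z) * (suc z * motzkin z 0 (levels z a q b))
      ≡⟨ cong₂ (λ u v → u + (z + z) * v) (levels-closed b a (suc q)) (levels-closed b a q) ⟩
    closed (suc (a + suc q + b)) (suc a) b + (z + z) * closed (suc (a + q + b)) (suc a) b
      ≡⟨ cong (λ n → closed (suc n) (suc a) b + (z + z) * closed (suc (a + q + b)) (suc a) b)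
              (cong (_+ b) (+-suc a q)) ⟩
    closed (2 + (a + q + b)) (suc a) b + (z + z) * closed (suc (a + q + b)) (suc a) b
      ≡⟨ sym (closed-suc-j (suc (a + q + b)) (suc a) b) ⟩
    closed (2 + (a + q + b)) (suc a) (suc b)
      ≡⟨ cong (λ n → closed (suc n) (suc a) (suc b)) (sym (+-suc (a + q) b)) ⟩
    closed (suc (a + q + suc b)) (suc a) (suc b) ∎
    where
    open ≡-Reasoning
    distrib : ∀ y w u v → y * (u + w * v) ≡ y * u + w * (y * v)
    distrib = solve-∀

  closed-innerSum : ∀ n i j →
    sumTo n (λ k → catalan (n ∸ k) * innerSum (suc n) i j k * z ^ k) ≡ closed n i j
  closed-innerSum n i j = trans
    (sumTo-cong n (λ k k≤n → cong (λ a → catalan (n ∸ k) * a * z ^ k) (inner k k≤n)))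
    (sumTo≡antisum n (term i j))
    where
    inner : ∀ k → k ≤ n → innerSum (suc n) i j k ≡ innerCoeff (n ∸ k + i) j k
    inner k k≤n = trans
      (sumTo-cong j (λ s _ → cong (λ a → (j C s) * binomDiff (a ∸ s) k s)
        (trans (+-∸-comm {n + i} j {k} (≤-trans k≤n (m≤m+n n i)))
               (cong (_+ j) (+-∸-comm {n} i {k} k≤n)))))
      (innerCoeff-sum (n ∸ k + i) j k)

-- Noncrossing partitions as stack runs

listSum : {A : Set} → (A → ℕ) → List A → ℕ
listSum f [] = 0
listSum f (x ∷ xs) = f x + listSum f xs

module _ {A : Set} where

  listSum-cong : ∀ {f g : A → ℕ} xs → (∀ x → f x ≡ g x) → listSum f xs ≡ listSum g xs
  listSum-cong [] f≗g = refl
  listSum-cong (x ∷ xs) f≗g = cong₂ _+_ (f≗g x) (listSum-cong xs f≗g)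

  listSum-++ : ∀ (f : A → ℕ) xs ys → listSum f (xs ++ ys) ≡ listSum f xs + listSum f ys
  listSum-++ f [] ys = refl
  listSum-++ f (x ∷ xs) ys = trans (cong (f x +_) (listSum-++ f xs ys)) (sym (+-assoc (f x) _ _))

  listSum-+ : ∀ (f g : A → ℕ) xs → listSum (λ x → f x + g x) xs ≡ listSum f xs + listSum g xs
  listSum-+ f g [] = refl
  listSum-+ f g (x ∷ xs) rewrite listSum-+ f g xs = arith (f x) (g x) (listSum f xs) (listSum g xs)
    where
    arith : ∀ a b c e → a + b + (c + e) ≡ a + c + (b + e)
    arith = solve-∀

  listSum-* : ∀ c (f : A → ℕ) xs → listSum (λ x → c * f x) xs ≡ c * listSum f xs
  listSum-* c f [] = sym (*-zeroʳ c)
  listSum-* c f (x ∷ xs) rewrite listSum-* c f xs = sym (*-distribˡ-+ c (f x) _)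

  listSum-zero : ∀ (f : A → ℕ) xs → (∀ x → f x ≡ 0) → listSum f xs ≡ 0
  listSum-zero f [] f≗0 = refl
  listSum-zero f (x ∷ xs) f≗0 = cong₂ _+_ (f≗0 x) (listSum-zero f xs f≗0)

listSum-map : ∀ {A B : Set} (f : B → ℕ) (h : A → B) xs → listSum f (map h xs) ≡ listSum (λ x → f (h x)) xs
listSum-map f h [] = refl
listSum-map f h (x ∷ xs) = cong (f (h x) +_) (listSum-map f h xs)

listSum-lists : ∀ n r (f : List ℕ → ℕ) →
  listSum f (lists n (suc r)) ≡ listSum (λ x → listSum (λ q → f (x ∷ q)) (lists n r)) (range1 n)
listSum-lists n r f = go (range1 n)
  where
  go : ∀ xs → listSum f (concatMap (λ x → map (x ∷_) (lists n r)) xs)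
    ≡ listSum (λ x → listSum (λ q → f (x ∷ q)) (lists n r)) xs
  go [] = refl
  go (x ∷ xs) = trans (listSum-++ f (map (x ∷_) (lists n r)) _)
    (cong₂ _+_ (listSum-map f (x ∷_) (lists n r)) (go xs))

interval : ℕ → ℕ → List ℕ
interval v zero = []
interval v (suc r) = v ∷ interval (suc v) r

range1≡interval : ∀ n → range1 n ≡ interval 1 n
range1≡interval n = go 0 (λ x → x) n (λ _ → refl)
  where
  go : ∀ v (f : ℕ → ℕ) r → (∀ k → f k ≡ v + k) → map suc (applyUpTo f r) ≡ interval (suc v) r
  go v f zero f≗ = refl
  go v f (suc r) f≗ = cong₂ _∷_ (cong suc (trans (f≗ 0) (+-identityʳ v)))
    (go (suc v) (λ k → f (suc k)) r (λ k → trans (f≗ (suc k)) (+-suc v k)))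

∈-interval⁻ : ∀ {u} v r → u ∈ interval v r → v ≤ u × u < v + r
∈-interval⁻ v (suc r) (here refl) = ≤-refl , m<m+n v z<s
∈-interval⁻ {u} v (suc r) (there u∈) with v<u , u< ← ∈-interval⁻ (suc v) r u∈ =
  <⇒≤ v<u , subst (u <_) (sym (+-suc v r)) u<

∈-interval⁺ : ∀ {u} v r → v ≤ u → u < v + r → u ∈ interval v r
∈-interval⁺ {u} v zero v≤u u< = ⊥-elim (<⇒≱ u< (subst (_≤ u) (sym (+-identityʳ v)) v≤u))
∈-interval⁺ {u} v (suc r) v≤u u< with v ≟ u
... | yes refl = here refl
... | no v≢u = there (∈-interval⁺ (suc v) r (≤∧≢⇒< v≤u v≢u) (subst (u <_) (+-suc v r) u<))

∈-range1⁻ : ∀ {u} n → u ∈ range1 n → 1 ≤ u × u ≤ n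
∈-range1⁻ n u∈ with 1≤u , u<1+n ← ∈-interval⁻ 1 n (subst (_ ∈_) (range1≡interval n) u∈) =
  1≤u , s≤s⁻¹ u<1+n

∈-range1⁺ : ∀ {u} n → 1 ≤ u → u ≤ n → u ∈ range1 n
∈-range1⁺ n 1≤u u≤n = subst (_ ∈_) (sym (range1≡interval n)) (∈-interval⁺ 1 n 1≤u (s≤s u≤n))

restrict : {P : Set} → Dec P → ℕ → ℕ
restrict d w = if does d then w else 0

restrict-yes : {P : Set} (d : Dec P) (w : ℕ) → P → restrict d w ≡ w
restrict-yes (yes _) w p = refl
restrict-yes (no ¬p) w p = ⊥-elim (¬p p)

restrict-no : {P : Set} (d : Dec P) (w : ℕ) → ¬ P → restrict d w ≡ 0
restrict-no (yes p) w ¬p = ⊥-elim (¬p p)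
restrict-no (no _) w ¬p = refl

restrict-⇔ : {P Q : Set} (d : Dec P) (e : Dec Q) (w : ℕ) → (P → Q) → (Q → P) →
  restrict d w ≡ restrict e w
restrict-⇔ (yes p) e w to from = sym (restrict-yes e w (to p))
restrict-⇔ (no ¬p) e w to from = sym (restrict-no e w (λ q → ¬p (from q)))

restrict-* : {P : Set} (d : Dec P) (c w : ℕ) → restrict d (c * w) ≡ c * restrict d w
restrict-* (yes _) c w = refl
restrict-* (no _) c w = sym (*-zeroʳ c)

listSum-range1-one : ∀ n v w → 1 ≤ v → v ≤ n → listSum (λ x → restrict (x ≟ v) w) (range1 n) ≡ w
listSum-range1-one n v w 1≤v v≤n rewrite range1≡interval n = go 1 n 1≤v (s≤s v≤n)
  where
  after : ∀ u r → v < u → listSum (λ x → restrict (x ≟ v) w) (interval u r) ≡ 0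
  after u zero v<u = refl
  after u (suc r) v<u = cong₂ _+_ (restrict-no (u ≟ v) w (λ u≡v → <-irrefl (sym u≡v) v<u))
    (after (suc u) r (m<n⇒m<1+n v<u))
  go : ∀ u r → u ≤ v → v < u + r → listSum (λ x → restrict (x ≟ v) w) (interval u r) ≡ w
  go u zero u≤v v< = ⊥-elim (<⇒≱ v< (subst (_≤ v) (sym (+-identityʳ u)) u≤v))
  go u (suc r) u≤v v< with u ≟ v
  ... | yes refl = trans (cong₂ _+_ (restrict-yes (u ≟ u) w refl) (after (suc u) r ≤-refl)) (+-identityʳ w)
  ... | no u≢v = trans
    (cong (_+ listSum (λ x → restrict (x ≟ v) w) (interval (suc u) r)) (restrict-no (u ≟ v) w u≢v))
    (go (suc u) r (≤∧≢⇒< u≤v u≢v) (subst (v <_) (+-suc u r) v<))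

listSum-range1-cong : ∀ n {f g : ℕ → ℕ} → (∀ x → 1 ≤ x → x ≤ n → f x ≡ g x) →
  listSum f (range1 n) ≡ listSum g (range1 n)
listSum-range1-cong n {f} {g} f≗g =
  go (range1 n) (λ x x∈ → f≗g x (proj₁ (∈-range1⁻ n x∈)) (proj₂ (∈-range1⁻ n x∈)))
  where
  go : ∀ xs → (∀ x → x ∈ xs → f x ≡ g x) → listSum f xs ≡ listSum g xs
  go [] f≗g = refl
  go (x ∷ xs) f≗g = cong₂ _+_ (f≗g x (here refl)) (go xs (λ x x∈ → f≗g x (there x∈)))

listSum-lists-cong : ∀ n r {f g : List ℕ → ℕ} →
  (∀ q → length q ≡ r → All (1 ≤_) q → f q ≡ g q) → listSum f (lists n r) ≡ listSum g (lists n r)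
listSum-lists-cong n zero f≗g = cong (_+ 0) (f≗g [] refl [])
listSum-lists-cong n (suc r) {f} {g} f≗g = trans (listSum-lists n r f) (trans
  (listSum-range1-cong n (λ x 1≤x _ →
    listSum-lists-cong n r (λ q ∣q∣ 1≤q → f≗g (x ∷ q) (cong suc ∣q∣) (1≤x ∷ 1≤q))))
  (sym (listSum-lists n r g)))

-- Step S v x q S′ reads the letter x at position v, with q still to come. The stack holds the minima
-- of the blocks that occur again in the rest of the word; its bottom entry is never removed.
data Step : List ℕ → ℕ → ℕ → List ℕ → List ℕ → Set where
  opens  : ∀ {S v q} → v ∈ q → Step S v v q (v ∷ S)
  single : ∀ {S v q} → v ∉ q → Step S v v q S
  stays  : ∀ {S m v q} → m ≢ v → m ∈ q → Step (m ∷ S) v m q (m ∷ S)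
  closes : ∀ {S m m′ v q} → m ≢ v → m ∉ q → Step (m ∷ m′ ∷ S) v m q (m′ ∷ S)
  rests  : ∀ {m v q} → m ≢ v → m ∉ q → Step (m ∷ []) v m q (m ∷ [])

data Run : List ℕ → ℕ → List ℕ → Set where
  stop : ∀ {m v} → Run (m ∷ []) v []
  _then_ : ∀ {S S′ v x q} → Step S v x q S′ → Run S′ (suc v) q → Run S v (x ∷ q)

-- Whether x is new, whether it recurs in `q` and the shape of the stack fix the rule. This
-- determinism allows a run to be decided, and its weight to be factored, one letter at a time.
step-unique : ∀ {S v x q T U} → Step S v x q T → Step S v x q U → T ≡ U
step-unique (opens _) (opens _) = refl
step-unique (opens x∈q) (single x∉q) = ⊥-elim (x∉q x∈q)
step-unique (opens _) (stays v≢v _) = ⊥-elim (v≢v refl)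
step-unique (opens _) (closes v≢v _) = ⊥-elim (v≢v refl)
step-unique (opens _) (rests v≢v _) = ⊥-elim (v≢v refl)
step-unique (single x∉q) (opens x∈q) = ⊥-elim (x∉q x∈q)
step-unique (single _) (single _) = refl
step-unique (single _) (stays v≢v _) = ⊥-elim (v≢v refl)
step-unique (single _) (closes v≢v _) = ⊥-elim (v≢v refl)
step-unique (single _) (rests v≢v _) = ⊥-elim (v≢v refl)
step-unique (stays v≢v _) (opens _) = ⊥-elim (v≢v refl)
step-unique (stays v≢v _) (single _) = ⊥-elim (v≢v refl)
step-unique (stays _ _) (stays _ _) = refl
step-unique (stays _ x∈q) (closes _ x∉q) = ⊥-elim (x∉q x∈q)
step-unique (stays _ _) (rests _ _) = refl
step-unique (closes v≢v _) (opens _) = ⊥-elim (v≢v refl)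
step-unique (closes v≢v _) (single _) = ⊥-elim (v≢v refl)
step-unique (closes _ x∉q) (stays _ x∈q) = ⊥-elim (x∉q x∈q)
step-unique (closes _ _) (closes _ _) = refl
step-unique (rests v≢v _) (opens _) = ⊥-elim (v≢v refl)
step-unique (rests v≢v _) (single _) = ⊥-elim (v≢v refl)
step-unique (rests _ _) (stays _ _) = refl
step-unique (rests _ _) (rests _ _) = refl

run-tail : ∀ {S v x q S′} → Step S v x q S′ → Run S v (x ∷ q) → Run S′ (suc v) q
run-tail {v = v} {q = q} s (s′ then R) = subst (λ T → Run T (suc v) q) (step-unique s′ s) R

step-other : ∀ {m S v x q S′} → x ≢ v → x ≢ m → ¬ Step (m ∷ S) v x q S′
step-other x≢v x≢m (opens _) = x≢v refl
step-other x≢v x≢m (single _) = x≢v refl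
step-other x≢v x≢m (stays _ _) = x≢m refl
step-other x≢v x≢m (closes _ _) = x≢m refl
step-other x≢v x≢m (rests _ _) = x≢m refl

step? : ∀ S v x q → Dec (∃[ S′ ] Step S v x q S′)
step? S v x q with x ≟ v | x ∈? q
step? S v x q | yes refl | yes x∈q = yes (_ , opens x∈q)
step? S v x q | yes refl | no x∉q = yes (_ , single x∉q)
step? [] v x q | no x≢v | _ = no λ { (_ , opens _) → x≢v refl ; (_ , single _) → x≢v refl }
step? (m ∷ S) v x q | no x≢v | x∈?q with x ≟ m
step? (m ∷ S) v x q | no x≢v | _ | no x≢m = no λ (_ , s) → step-other x≢v x≢m s
step? (m ∷ S) v x q | no x≢v | yes x∈q | yes refl = yes (_ , stays x≢v x∈q)
step? (m ∷ []) v x q | no x≢v | no x∉q | yes refl = yes (_ , rests x≢v x∉q)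
step? (m ∷ m′ ∷ S) v x q | no x≢v | no x∉q | yes refl = yes (_ , closes x≢v x∉q)

run? : ∀ S v q → Dec (Run S v q)
run? [] v [] = no λ ()
run? (m ∷ []) v [] = yes stop
run? (m ∷ m′ ∷ S) v [] = no λ ()
run? S v (x ∷ q) with step? S v x q
... | no ¬s = no λ { (s then R) → ¬s (_ , s) }
... | yes (S′ , s) = map′ (s then_) (run-tail s) (run? S′ (suc v) q)

-- Stack κ h v S: S has height h over the bottom entry κ and strictly decreasing entries below v.
data Stack (κ : ℕ) : ℕ → ℕ → List ℕ → Set where
  bottom : ∀ {v} → κ < v → Stack κ 0 v (κ ∷ [])
  push   : ∀ {h m v S} → m < v → Stack κ h m S → Stack κ (suc h) v (m ∷ S)

module _ {κ : ℕ} where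

  κ<bound : ∀ {h v S} → Stack κ h v S → κ < v
  κ<bound (bottom κ<v) = κ<v
  κ<bound (push m<v st) = <-trans (κ<bound st) m<v

  ∈⇒<bound : ∀ {h v S m} → Stack κ h v S → m ∈ S → m < v
  ∈⇒<bound (bottom κ<v) (here refl) = κ<v
  ∈⇒<bound (push m<v st) (here refl) = m<v
  ∈⇒<bound (push m<v st) (there m∈S) = <-trans (∈⇒<bound st m∈S) m<v

  ∈⇒≤head : ∀ {h v S m m′} → Stack κ h v (m ∷ S) → m′ ∈ m ∷ S → m′ ≤ m
  ∈⇒≤head st (here refl) = ≤-refl
  ∈⇒≤head (push m<v st) (there m′∈S) = <⇒≤ (∈⇒<bound st m′∈S)

  raise : ∀ {h v w S} → v ≤ w → Stack κ h v S → Stack κ h w S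
  raise v≤w (bottom κ<v) = bottom (<-≤-trans κ<v v≤w)
  raise v≤w (push m<v st) = push (<-≤-trans m<v v≤w) st

  step-stack : ∀ {h S v x q S′} → Stack κ h v S → Step S v x q S′ → ∃[ h′ ] Stack κ h′ (suc v) S′
  step-stack st (opens _) = _ , push ≤-refl st
  step-stack st (single _) = _ , raise (n≤1+n _) st
  step-stack st (stays _ _) = _ , raise (n≤1+n _) st
  step-stack (push m<v st) (closes _ _) = _ , raise (m≤n⇒m≤1+n (<⇒≤ m<v)) st
  step-stack st (rests _ _) = _ , raise (n≤1+n _) st

  close-top : ∀ {h S m v q} → Stack κ h m S → m ≢ v → m ∉ q → Step (m ∷ S) v m q S
  close-top (bottom _) = closes
  close-top (push _ _) = closes

keep-bottom : ∀ {m v q} → m ≢ v → Step (m ∷ []) v m q (m ∷ [])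
keep-bottom {m} {q = q} m≢v with m ∈? q
... | yes m∈q = stays m≢v m∈q
... | no m∉q = rests m≢v m∉q

step-∈⁻ : ∀ {S v x q S′ m} → Step S v x q S′ → m ∈ S′ → m ∈ S ⊎ (m ≡ v × x ≡ v)
step-∈⁻ (opens _) (here refl) = inj₂ (refl , refl)
step-∈⁻ (opens _) (there m∈S) = inj₁ m∈S
step-∈⁻ (single _) m∈S = inj₁ m∈S
step-∈⁻ (stays _ _) m∈S = inj₁ m∈S
step-∈⁻ (closes _ _) m∈S = inj₁ (there m∈S)
step-∈⁻ (rests _ _) m∈S = inj₁ m∈S

step-current : ∀ {S v x q S′} → Step S v x q S′ → x ≡ v ⊎ (∃[ T ] S ≡ x ∷ T)
step-current (opens _) = inj₁ refl
step-current (single _) = inj₁ refl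
step-current (stays _ _) = inj₂ (_ , refl)
step-current (closes _ _) = inj₂ (_ , refl)
step-current (rests _ _) = inj₂ (_ , refl)

step-current-∈ : ∀ {S v x q S′} → Step S v x q S′ → x ∈ q → ∃[ T ] S′ ≡ x ∷ T
step-current-∈ (opens _) x∈q = _ , refl
step-current-∈ (single x∉q) x∈q = ⊥-elim (x∉q x∈q)
step-current-∈ (stays _ _) x∈q = _ , refl
step-current-∈ (closes _ x∉q) x∈q = ⊥-elim (x∉q x∈q)
step-current-∈ (rests _ x∉q) x∈q = ⊥-elim (x∉q x∈q)

step-∈⁺ : ∀ {S v x q S′ m} → Step S v x q S′ → m ∈ S → m ∈ q → m ∈ S′
step-∈⁺ (opens _) m∈S m∈q = there m∈S
step-∈⁺ (single _) m∈S m∈q = m∈S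
step-∈⁺ (stays _ _) m∈S m∈q = m∈S
step-∈⁺ (closes _ x∉q) (here refl) m∈q = ⊥-elim (x∉q m∈q)
step-∈⁺ (closes _ x∉q) (there m∈S) m∈q = m∈S
step-∈⁺ (rests _ _) m∈S m∈q = m∈S

-- A letter below v can only be read while it is on top of the stack, and from position v on only
-- letters at least v are pushed.
run-∈⁻ : ∀ {S v q m} → Run S v q → m ∈ q → m < v → m ∈ S
run-∈⁻ (s then R) (here refl) m<v with step-current s
... | inj₁ refl = ⊥-elim (<-irrefl refl m<v)
... | inj₂ (_ , refl) = here refl
run-∈⁻ (s then R) (there m∈q) m<v with step-∈⁻ s (run-∈⁻ R m∈q (m<n⇒m<1+n m<v))
... | inj₁ m∈S = m∈S
... | inj₂ (refl , _) = ⊥-elim (<-irrefl refl m<v)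

-- A run ends with the bottom entry alone, and an entry above it is removed only by a step that
-- reads it.
run-∈⁺ : ∀ {κ h S v q m} → Stack κ h v S → Run S v q → m ∈ S → κ < m → m ∈ q
run-∈⁺ (bottom _) stop (here refl) κ<m = ⊥-elim (<-irrefl refl κ<m)
run-∈⁺ (push _ ()) stop m∈S κ<m
run-∈⁺ {q = x ∷ q} {m} st (s then R) m∈S κ<m with m ≟ x | m ∈? q
... | yes refl | _ = here refl
... | no m≢x | yes m∈q = there m∈q
... | no m≢x | no m∉q = there (run-∈⁺ (proj₂ (step-stack st s)) R (remains s m∈S) κ<m)
  where
  remains : ∀ {S v S′} → Step S v x q S′ → m ∈ S → m ∈ S′
  remains (opens _) m∈S = there m∈S
  remains (single _) m∈S = m∈S
  remains (stays _ _) m∈S = m∈S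
  remains (closes _ _) (here refl) = ⊥-elim (m≢x refl)
  remains (closes _ _) (there m∈S) = m∈S
  remains (rests _ _) m∈S = m∈S

-- Weighted runs and weighted walks

module Weights (κ z : ℕ) (s t : ℕ → ℕ) where

  -- `s` weighs singletons, and `t` the nonminimal elements that are not last in their block. A last
  -- element weighs 1, except in the block `κ`, where it weighs `t` as well. `later` tells whether
  -- the letter recurs.
  weightAt : ℕ → ℕ → Bool → ℕ
  weightAt v x later =
    if does (x ≟ v) then (if later then suc z else s v)
    else if later then t v
    else if does (x ≟ κ) then t v
    else 1

  weight : ℕ → List ℕ → ℕ
  weight v [] = 1
  weight v (x ∷ q) = weightAt v x (does (x ∈? q)) * weight (suc v) q

  weight-opens : ∀ {v q} → v ∈ q → weight v (v ∷ q) ≡ suc z * weight (suc v) q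
  weight-opens {v} {q} v∈q rewrite dec-true (v ≟ v) refl | dec-true (v ∈? q) v∈q = refl

  weight-single : ∀ {v q} → v ∉ q → weight v (v ∷ q) ≡ s v * weight (suc v) q
  weight-single {v} {q} v∉q rewrite dec-true (v ≟ v) refl | dec-false (v ∈? q) v∉q = refl

  weight-stays : ∀ {v x q} → x ≢ v → x ∈ q → weight v (x ∷ q) ≡ t v * weight (suc v) q
  weight-stays {v} {x} {q} x≢v x∈q
    rewrite dec-false (x ≟ v) x≢v | dec-true (x ∈? q) x∈q = refl

  weight-rests : ∀ {v q} → κ ≢ v → weight v (κ ∷ q) ≡ t v * weight (suc v) q
  weight-rests {v} {q} κ≢v with κ ∈? q
  ... | yes κ∈q rewrite dec-false (κ ≟ v) κ≢v = refl
  ... | no κ∉q rewrite dec-false (κ ≟ v) κ≢v | dec-true (κ ≟ κ) refl = refl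

  weight-closes : ∀ {v x q} → x ≢ v → x ∉ q → x ≢ κ → weight v (x ∷ q) ≡ weight (suc v) q
  weight-closes {v} {x} {q} x≢v x∉q x≢κ
    rewrite dec-false (x ≟ v) x≢v | dec-false (x ∈? q) x∉q | dec-false (x ≟ κ) x≢κ =
    *-identityˡ _

  runWeight : List ℕ → ℕ → List ℕ → ℕ
  runWeight S v q = restrict (run? S v q) (weight v q)

  -- Here `κ` acts as the number 0 or 1: at height 0 an old letter can be read only if the bottom
  -- entry is a genuine block.
  walk : ℕ → ℕ → ℕ → ℕ
  walk zero v zero = 1
  walk (suc h) v zero = 0
  walk zero v (suc r) = suc z * walk 1 (suc v) r + (s v + κ * t v) * walk 0 (suc v) r
  walk (suc h) v (suc r) =
    suc z * walk (2 + h) (suc v) r + (s v + t v) * walk (suc h) (suc v) r + walk h (suc v) r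

  runWeight-step : ∀ {S v x q S′} c → Step S v x q S′ →
    weight v (x ∷ q) ≡ c * weight (suc v) q → runWeight S v (x ∷ q) ≡ c * runWeight S′ (suc v) q
  runWeight-step {S} {v} {x} {q} {S′} c s w≡ = begin
    restrict (run? S v (x ∷ q)) (weight v (x ∷ q))
      ≡⟨ cong (restrict (run? S v (x ∷ q))) w≡ ⟩
    restrict (run? S v (x ∷ q)) (c * weight (suc v) q)
      ≡⟨ restrict-⇔ (run? S v (x ∷ q)) (run? S′ (suc v) q) _
           (run-tail s) (s then_) ⟩
    restrict (run? S′ (suc v) q) (c * weight (suc v) q)
      ≡⟨ restrict-* (run? S′ (suc v) q) c _ ⟩
    c * runWeight S′ (suc v) q ∎
    where open ≡-Reasoning

  -- Whether v recurs in `q` selects one of the two stacks, and from the other no run on `q` exists,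
  -- by `run-∈⁻` or `run-∈⁺`. Hence both terms may be added for every `q`, and the condition on the
  -- future is gone before `q` is summed over. `runWeight-top` rests on the same principle.
  runWeight-new : ∀ {h S v} q → Stack κ h v S →
    runWeight S v (v ∷ q) ≡ suc z * runWeight (v ∷ S) (suc v) q + s v * runWeight S (suc v) q
  runWeight-new {h} {S} {v} q st = by (v ∈? q)
    where
    by : Dec (v ∈ q) → runWeight S v (v ∷ q)
      ≡ suc z * runWeight (v ∷ S) (suc v) q + s v * runWeight S (suc v) q
    by (yes v∈q) = trans (runWeight-step (suc z) (opens {S = S} v∈q) (weight-opens v∈q))
      (sym (trans (cong (λ u → suc z * runWeight (v ∷ S) (suc v) q + s v * u)
        (restrict-no (run? S (suc v) q) _ (λ R → <-irrefl refl (∈⇒<bound st (run-∈⁻ R v∈q ≤-refl)))))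
        (trans (cong (suc z * runWeight (v ∷ S) (suc v) q +_) (*-zeroʳ (s v))) (+-identityʳ _))))
    by (no v∉q) = trans (runWeight-step (s v) (single {S = S} v∉q) (weight-single v∉q))
      (sym (cong (_+ s v * runWeight S (suc v) q) (trans (cong (suc z *_)
        (restrict-no (run? (v ∷ S) (suc v) q) _
          (λ R → v∉q (run-∈⁺ (push ≤-refl st) R (here refl) (κ<bound st)))))
        (*-zeroʳ (suc z)))))

  runWeight-bottom : ∀ {v} q → κ < v →
    runWeight (κ ∷ []) v (κ ∷ q) ≡ t v * runWeight (κ ∷ []) (suc v) q
  runWeight-bottom {v} q κ<v = runWeight-step (t v) (keep-bottom (<⇒≢ κ<v)) (weight-rests {q = q} (<⇒≢ κ<v))

  runWeight-top : ∀ {h S v m} q → m < v → Stack κ h m S →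
    runWeight (m ∷ S) v (m ∷ q) ≡ t v * runWeight (m ∷ S) (suc v) q + runWeight S (suc v) q
  runWeight-top {h} {S} {v} {m} q m<v st = by (m ∈? q)
    where
    by : Dec (m ∈ q) → runWeight (m ∷ S) v (m ∷ q)
      ≡ t v * runWeight (m ∷ S) (suc v) q + runWeight S (suc v) q
    by (yes m∈q) = trans (runWeight-step (t v) (stays {S = S} (<⇒≢ m<v) m∈q) (weight-stays (<⇒≢ m<v) m∈q))
      (sym (trans (cong (t v * runWeight (m ∷ S) (suc v) q +_)
        (restrict-no (run? S (suc v) q) _
          (λ R → <-irrefl refl (∈⇒<bound st (run-∈⁻ R m∈q (m<n⇒m<1+n m<v))))))
        (+-identityʳ _)))
    by (no m∉q) = trans (runWeight-step 1 (close-top st (<⇒≢ m<v) m∉q)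
        (trans (weight-closes (<⇒≢ m<v) m∉q (λ { refl → <-irrefl refl (κ<bound st) })) (sym (*-identityˡ _))))
      (trans (*-identityˡ _) (sym (cong (_+ runWeight S (suc v) q) (trans (cong (t v *_)
        (restrict-no (run? (m ∷ S) (suc v) q) _
          (λ R → m∉q (run-∈⁺ (push (m<n⇒m<1+n m<v) st) R (here refl) (κ<bound st)))))
        (*-zeroʳ (t v))))))

  runWeight-other : ∀ {S v m x} q → x ≢ v → x ≢ m → runWeight (m ∷ S) v (x ∷ q) ≡ 0
  runWeight-other {S} {v} {m} {x} q x≢v x≢m =
    restrict-no (run? (m ∷ S) v (x ∷ q)) _ λ { (s then _) → step-other x≢v x≢m s }

  -- For κ = 1 the bottom entry is the block of 1, which stays available for ever; for κ = 0 it is a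
  -- dummy, since all letters are positive.
  module _ (n : ℕ) (κ≤1 : κ ≤ 1) where

    totalWeight : List ℕ → ℕ → ℕ → ℕ
    totalWeight S v r = listSum (runWeight S v) (lists n r)

    -- Only v itself and the top of the stack can be read. Letters are at least 1, so the second
    -- contribution is absent when the top is the dummy 0.
    totalWeight-suc : ∀ {m S} v r A B → m < v → v ≤ n →
      listSum (λ q → runWeight (m ∷ S) v (v ∷ q)) (lists n r) ≡ A →
      listSum (λ q → runWeight (m ∷ S) v (m ∷ q)) (lists n r) ≡ B →
      totalWeight (m ∷ S) v (suc r) ≡ A + restrict (1 ≤? m) B
    totalWeight-suc {m} {S} v r A B m<v v≤n v≡A m≡B = begin
      totalWeight (m ∷ S) v (suc r)
        ≡⟨ listSum-lists n r (runWeight (m ∷ S) v) ⟩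
      listSum (λ x → listSum (λ q → runWeight (m ∷ S) v (x ∷ q)) (lists n r)) (range1 n)
        ≡⟨ listSum-range1-cong n (λ x _ _ → split x) ⟩
      listSum (λ x → restrict (x ≟ v) A + restrict (x ≟ m) B) (range1 n)
        ≡⟨ listSum-+ (λ x → restrict (x ≟ v) A) (λ x → restrict (x ≟ m) B) (range1 n) ⟩
      listSum (λ x → restrict (x ≟ v) A) (range1 n) + listSum (λ x → restrict (x ≟ m) B) (range1 n)
        ≡⟨ cong₂ _+_ (listSum-range1-one n v A (≤-trans (s≤s z≤n) m<v) v≤n) second ⟩
      A + restrict (1 ≤? m) B ∎
      where
      open ≡-Reasoning
      second : listSum (λ x → restrict (x ≟ m) B) (range1 n) ≡ restrict (1 ≤? m) B
      second with 1 ≤? m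
      ... | yes 1≤m = trans (listSum-range1-one n m B 1≤m (≤-trans (<⇒≤ m<v) v≤n))
                            (sym (restrict-yes (1 ≤? m) B 1≤m))
      ... | no 1≰m = trans (listSum-range1-cong n (λ x 1≤x _ →
          restrict-no (x ≟ m) B (λ { refl → 1≰m 1≤x })))
        (trans (listSum-zero (λ _ → 0) (range1 n) (λ _ → refl)) (sym (restrict-no (1 ≤? m) B 1≰m)))
      split : ∀ x → listSum (λ q → runWeight (m ∷ S) v (x ∷ q)) (lists n r)
        ≡ restrict (x ≟ v) A + restrict (x ≟ m) B
      split x = by (x ≟ v) (x ≟ m)
        where
        by : Dec (x ≡ v) → Dec (x ≡ m) → listSum (λ q → runWeight (m ∷ S) v (x ∷ q)) (lists n r)
          ≡ restrict (x ≟ v) A + restrict (x ≟ m) B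
        by (yes refl) _ = trans v≡A (sym (trans (cong₂ _+_ (restrict-yes (v ≟ v) A refl)
          (restrict-no (v ≟ m) B (λ v≡m → <⇒≢ m<v (sym v≡m)))) (+-identityʳ A)))
        by (no x≢v) (yes refl) = trans m≡B (sym (cong₂ _+_ (restrict-no (m ≟ v) A x≢v)
          (restrict-yes (m ≟ m) B refl)))
        by (no x≢v) (no x≢m) = trans (listSum-zero _ (lists n r) (λ q → runWeight-other {S} q x≢v x≢m))
          (sym (cong₂ _+_ (restrict-no (x ≟ v) A x≢v) (restrict-no (x ≟ m) B x≢m)))

    listSum-linear : ∀ c e (f g : List ℕ → ℕ) xs →
      listSum (λ q → c * f q + e * g q) xs ≡ c * listSum f xs + e * listSum g xs
    listSum-linear c e f g xs = trans (listSum-+ (λ q → c * f q) (λ q → e * g q) xs)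
      (cong₂ _+_ (listSum-* c f xs) (listSum-* e g xs))

    -- Only the number of stack entries matters: each stack offers one new letter and at most one
    -- old one, its top. The equation `v + r ≡ suc n` keeps v within the alphabet.
    totalWeight≡walk : ∀ {h S} v r → Stack κ h v S → v + r ≡ suc n → totalWeight S v r ≡ walk h v r
    totalWeight≡walk v zero (bottom _) _ = refl
    totalWeight≡walk v zero (push _ (bottom _)) _ = refl
    totalWeight≡walk v zero (push _ (push _ _)) _ = refl
    totalWeight≡walk {S = S} v (suc r) st@(bottom κ<v) v+r≡ = begin
      totalWeight S v (suc r)
        ≡⟨ totalWeight-suc {S = []} v r (suc z * walk 1 (suc v) r + s v * walk 0 (suc v) r)
             (t v * walk 0 (suc v) r) κ<v v≤n new
             (trans (listSum-cong (lists n r) (λ q → runWeight-bottom q κ<v))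
               (trans (listSum-* (t v) _ (lists n r)) (cong (t v *_) same-level))) ⟩
      suc z * walk 1 (suc v) r + s v * walk 0 (suc v) r + restrict (1 ≤? κ) (t v * walk 0 (suc v) r)
        ≡⟨ cong (suc z * walk 1 (suc v) r + s v * walk 0 (suc v) r +_) (bottomWeight κ≤1) ⟩
      suc z * walk 1 (suc v) r + s v * walk 0 (suc v) r + κ * (t v * walk 0 (suc v) r)
        ≡⟨ arith (suc z * walk 1 (suc v) r) (s v) (walk 0 (suc v) r) κ (t v) ⟩
      walk 0 v (suc r) ∎
      where
      open ≡-Reasoning
      v+r≡′ : suc v + r ≡ suc n
      v+r≡′ = trans (sym (+-suc v r)) v+r≡
      v≤n : v ≤ n
      v≤n = s≤s⁻¹ (subst (suc v ≤_) v+r≡′ (m≤m+n (suc v) r))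
      same-level : totalWeight S (suc v) r ≡ walk 0 (suc v) r
      same-level = totalWeight≡walk (suc v) r (raise (n≤1+n v) st) v+r≡′
      new : listSum (λ q → runWeight S v (v ∷ q)) (lists n r)
        ≡ suc z * walk 1 (suc v) r + s v * walk 0 (suc v) r
      new = trans (listSum-cong (lists n r) (λ q → runWeight-new q st))
        (trans (listSum-linear (suc z) (s v) (runWeight (v ∷ S) (suc v)) (runWeight S (suc v)) (lists n r))
          (cong₂ (λ a b → suc z * a + s v * b)
            (totalWeight≡walk (suc v) r (push ≤-refl st) v+r≡′) same-level))
      bottomWeight : ∀ {κ w} → κ ≤ 1 → restrict (1 ≤? κ) w ≡ κ * w
      bottomWeight z≤n = refl
      bottomWeight (s≤s z≤n) = sym (*-identityˡ _)
      arith : ∀ a s w κ t → a + s * w + κ * (t * w) ≡ a + (s + κ * t) * w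
      arith = solve-∀
    totalWeight≡walk {S = S} v (suc r) st@(push {h} {m} {S = S′} m<v st′) v+r≡ = begin
      totalWeight S v (suc r)
        ≡⟨ totalWeight-suc {S = S′} v r (suc z * walk (2 + h) (suc v) r + s v * walk (suc h) (suc v) r)
             (t v * walk (suc h) (suc v) r + walk h (suc v) r) m<v v≤n new top ⟩
      suc z * walk (2 + h) (suc v) r + s v * walk (suc h) (suc v) r
        + restrict (1 ≤? m) (t v * walk (suc h) (suc v) r + walk h (suc v) r)
        ≡⟨ cong (suc z * walk (2 + h) (suc v) r + s v * walk (suc h) (suc v) r +_)
                (restrict-yes (1 ≤? m) _ (≤-trans (s≤s z≤n) (κ<bound st′))) ⟩
      suc z * walk (2 + h) (suc v) r + s v * walk (suc h) (suc v) r
        + (t v * walk (suc h) (suc v) r + walk h (suc v) r)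
        ≡⟨ arith (suc z * walk (2 + h) (suc v) r) (s v) (walk (suc h) (suc v) r) (t v) _ ⟩
      walk (suc h) v (suc r) ∎
      where
      open ≡-Reasoning
      v+r≡′ : suc v + r ≡ suc n
      v+r≡′ = trans (sym (+-suc v r)) v+r≡
      v≤n : v ≤ n
      v≤n = s≤s⁻¹ (subst (suc v ≤_) v+r≡′ (m≤m+n (suc v) r))
      same-level : totalWeight S (suc v) r ≡ walk (suc h) (suc v) r
      same-level = totalWeight≡walk (suc v) r (raise (n≤1+n v) st) v+r≡′
      new : listSum (λ q → runWeight S v (v ∷ q)) (lists n r)
        ≡ suc z * walk (2 + h) (suc v) r + s v * walk (suc h) (suc v) r
      new = trans (listSum-cong (lists n r) (λ q → runWeight-new q st))
        (trans (listSum-linear (suc z) (s v) (runWeight (v ∷ S) (suc v)) (runWeight S (suc v)) (lists n r))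
          (cong₂ (λ a b → suc z * a + s v * b)
            (totalWeight≡walk (suc v) r (push ≤-refl st) v+r≡′) same-level))
      top : listSum (λ q → runWeight S v (m ∷ q)) (lists n r)
        ≡ t v * walk (suc h) (suc v) r + walk h (suc v) r
      top = trans (listSum-cong (lists n r) (λ q → runWeight-top q m<v st′))
        (trans (listSum-+ (λ q → t v * runWeight S (suc v) q) (runWeight S′ (suc v)) (lists n r))
          (cong₂ _+_ (trans (listSum-* (t v) (runWeight S (suc v)) (lists n r)) (cong (t v *_) same-level))
            (totalWeight≡walk (suc v) r (raise (m≤n⇒m≤1+n (<⇒≤ m<v)) st′) v+r≡′)))
      arith : ∀ a s w t u → a + s * w + (t * w + u) ≡ a + (s + t) * w + u
      arith = solve-∀

-- Partition and noncrossing conditions as propositions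

IsPartition : ℕ → List ℕ → Set
IsPartition n b = ∀ u → 1 ≤ u → u ≤ n → 1 ≤ at b u × at b u ≤ u × at b (at b u) ≡ at b u

IsNoncrossing : ℕ → List ℕ → Set
IsNoncrossing n b = ∀ a x c e → 1 ≤ a → a < x → x < c → c < e → e ≤ n →
  at b a ≡ at b c → at b x ≡ at b e → at b a ≡ at b x

T-∧⁻ : ∀ {x y} → T (x ∧ y) → T x × T y
T-∧⁻ = Equivalence.to T-∧

T-∧⁺ : ∀ {x y} → T x → T y → T (x ∧ y)
T-∧⁺ p q = Equivalence.from T-∧ (p , q)

T-implies⁻ : ∀ h {k} → T (not h ∨ k) → T h → T k
T-implies⁻ true p _ = p

T-implies⁺ : ∀ h {k} → (T h → T k) → T (not h ∨ k)
T-implies⁺ true p = p tt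
T-implies⁺ false p = tt

allB⁻ : ∀ xs P → T (allB xs P) → ∀ {u} → u ∈ xs → T (P u)
allB⁻ (x ∷ xs) P p (here refl) = proj₁ (T-∧⁻ p)
allB⁻ (x ∷ xs) P p (there u∈) = allB⁻ xs P (proj₂ (T-∧⁻ {P x} p)) u∈

allB⁺ : ∀ xs P → (∀ {u} → u ∈ xs → T (P u)) → T (allB xs P)
allB⁺ [] P p = tt
allB⁺ (x ∷ xs) P p = T-∧⁺ (p (here refl)) (allB⁺ xs P (λ u∈ → p (there u∈)))

anyB-true : ∀ {u} xs P → u ∈ xs → P u ≡ true → anyB xs P ≡ true
anyB-true (x ∷ xs) P (here refl) p rewrite p = refl
anyB-true (x ∷ xs) P (there u∈) p with P x
... | true = refl
... | false = anyB-true xs P u∈ p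

anyB-false : ∀ xs P → (∀ u → u ∈ xs → P u ≡ false) → anyB xs P ≡ false
anyB-false [] P p = refl
anyB-false (x ∷ xs) P p rewrite p x (here refl) = anyB-false xs P (λ u u∈ → p u (there u∈))

isPartition⁻ : ∀ n b → T (isPartition n b) → IsPartition n b
isPartition⁻ n b p u 1≤u u≤n
  with T-∧⁻ (allB⁻ (range1 n) _ p (∈-range1⁺ n 1≤u u≤n))
... | p₁ , p₂₃ with T-∧⁻ p₂₃
... | p₂ , p₃ = ≤ᵇ⇒≤ 1 _ p₁ , ≤ᵇ⇒≤ _ u p₂ , ≡ᵇ⇒≡ _ _ p₃

isPartition⁺ : ∀ n b → IsPartition n b → T (isPartition n b)
isPartition⁺ n b part = allB⁺ (range1 n) _ λ {u} u∈ →
  let 1≤u , u≤n = ∈-range1⁻ n u∈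
      p₁ , p₂ , p₃ = part u 1≤u u≤n
  in T-∧⁺ (≤⇒≤ᵇ p₁) (T-∧⁺ (≤⇒≤ᵇ p₂) (≡⇒≡ᵇ _ _ p₃))

isNoncrossing⁻ : ∀ n b → T (isNoncrossing n b) → IsNoncrossing n b
isNoncrossing⁻ n b p a x c e 1≤a a<x x<c c<e e≤n a~c x~e =
  ≡ᵇ⇒≡ _ _ (proj₁ (T-∧⁻ (T-implies⁻ _ holds
    (T-∧⁺ (<⇒<ᵇ a<x) (T-∧⁺ (<⇒<ᵇ x<c) (T-∧⁺ (<⇒<ᵇ c<e) (T-∧⁺ (≡⇒≡ᵇ _ _ a~c) (≡⇒≡ᵇ _ _ x~e))))))))
  where
  in-range : ∀ {u} → a ≤ u → u ≤ e → u ∈ range1 n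
  in-range a≤u u≤e = ∈-range1⁺ n (≤-trans 1≤a a≤u) (≤-trans u≤e e≤n)
  a≤x = <⇒≤ a<x
  x≤c = <⇒≤ x<c
  c≤e = <⇒≤ c<e
  holds = allB⁻ (range1 n) _ (allB⁻ (range1 n) _ (allB⁻ (range1 n) _ (allB⁻ (range1 n) _ p
    (in-range ≤-refl (≤-trans a≤x (≤-trans x≤c c≤e)))) (in-range a≤x (≤-trans x≤c c≤e)))
    (in-range (≤-trans a≤x x≤c) c≤e)) (in-range (≤-trans a≤x (≤-trans x≤c c≤e)) ≤-refl)

isNoncrossing⁺ : ∀ n b → IsNoncrossing n b → T (isNoncrossing n b)
isNoncrossing⁺ n b nc =
  allB⁺ (range1 n) _ λ {a} a∈ → allB⁺ (range1 n) _ λ {x} x∈ →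
  allB⁺ (range1 n) _ λ {c} c∈ → allB⁺ (range1 n) _ λ {e} e∈ →
  T-implies⁺ ((a <ᵇ x) ∧ (x <ᵇ c) ∧ (c <ᵇ e) ∧ same b a c ∧ same b x e) λ h →
    let a<x , h₁ = T-∧⁻ {a <ᵇ x} h
        x<c , h₂ = T-∧⁻ {x <ᵇ c} h₁
        c<e , h₃ = T-∧⁻ {c <ᵇ e} h₂
        ac , xe = T-∧⁻ {same b a c} h₃
        a~c = ≡ᵇ⇒≡ (at b a) (at b c) ac
        x~e = ≡ᵇ⇒≡ (at b x) (at b e) xe
        a~x = nc a x c e (proj₁ (∈-range1⁻ n a∈)) (<ᵇ⇒< a x a<x) (<ᵇ⇒< x c x<c)
                (<ᵇ⇒< c e c<e) (proj₂ (∈-range1⁻ n e∈)) a~c x~e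
    in T-∧⁺ (≡⇒≡ᵇ _ _ a~x) (T-∧⁺ ac (≡⇒≡ᵇ _ _ (trans a~x x~e)))

-- Correspondence of runs and noncrossing partitions

module _ (n : ℕ) (b : List ℕ) where

  record Suffix (v : ℕ) (q : List ℕ) : Set where
    field
      letter : ∀ k → at b (v + k) ≡ at q (suc k)
      extent : v + length q ≡ suc n

  open Suffix

  suffix-head : ∀ {v x q} → Suffix v (x ∷ q) → at b v ≡ x
  suffix-head {v} sf = trans (cong (at b) (sym (+-identityʳ v))) (letter sf 0)

  suffix-tail : ∀ {v x q} → Suffix v (x ∷ q) → Suffix (suc v) q
  suffix-tail {v} sf .letter k = trans (cong (at b) (sym (+-suc v k))) (letter sf (suc k))
  suffix-tail {v} {q = q} sf .extent = trans (sym (+-suc v (length q))) (extent sf)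

  suffix-≤ : ∀ {v x q} → Suffix v (x ∷ q) → v ≤ n
  suffix-≤ {v} {q = q} sf =
    s≤s⁻¹ (subst (suc v ≤_) (extent (suffix-tail sf)) (m≤m+n (suc v) (length q)))

  suffix-empty : ∀ {v u} → Suffix v [] → v ≤ u → u ≤ n → ⊥
  suffix-empty {v} {u} sf v≤u u≤n =
    1+n≰n (≤-trans (≤-reflexive (trans (sym (extent sf)) (+-identityʳ v))) (≤-trans v≤u u≤n))

  ∈-suffix⁺ : ∀ {u v} q → Suffix v q → v ≤ u → u ≤ n → at b u ∈ q
  ∈-suffix⁺ [] sf v≤u u≤n = ⊥-elim (suffix-empty sf v≤u u≤n)
  ∈-suffix⁺ (x ∷ q) sf v≤u u≤n with m≤n⇒m<n∨m≡n v≤u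
  ... | inj₁ v<u = there (∈-suffix⁺ q (suffix-tail sf) v<u u≤n)
  ... | inj₂ refl = here (suffix-head sf)

  ∈-suffix⁻ : ∀ {m v} q → Suffix v q → m ∈ q → ∃[ u ] v ≤ u × u ≤ n × at b u ≡ m
  ∈-suffix⁻ (x ∷ q) sf (here refl) = _ , ≤-refl , suffix-≤ sf , suffix-head sf
  ∈-suffix⁻ (x ∷ q) sf (there m∈q) with u , v<u , u≤n , bu≡m ← ∈-suffix⁻ q (suffix-tail sf) m∈q =
    u , <⇒≤ v<u , u≤n , bu≡m

  Fixed : List ℕ → Set
  Fixed S = ∀ {m} → m ∈ S → at b m ≡ m

  fixed-step : ∀ {S v x q S′} → Suffix v (x ∷ q) → Fixed S → Step S v x q S′ → Fixed S′
  fixed-step sf fix s m∈S′ with step-∈⁻ s m∈S′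
  ... | inj₁ m∈S = fix m∈S
  ... | inj₂ (refl , refl) = suffix-head sf

  module _ {κ : ℕ} where

    run⇒partition : ∀ {h v S q} → Stack κ h v S → Suffix v q → All (1 ≤_) q → Fixed S → Run S v q →
      ∀ u → v ≤ u → u ≤ n → 1 ≤ at b u × at b u ≤ u × at b (at b u) ≡ at b u
    run⇒partition st sf pos fix stop u v≤u u≤n = ⊥-elim (suffix-empty sf v≤u u≤n)
    run⇒partition st sf (1≤x ∷ pos) fix (s then R) u v≤u u≤n with m≤n⇒m<n∨m≡n v≤u
    ... | inj₁ v<u = run⇒partition (proj₂ (step-stack st s)) (suffix-tail sf) pos
                       (fixed-step sf fix s) R u v<u u≤n
    ... | inj₂ refl rewrite suffix-head sf with step-current s
    ...   | inj₁ refl = 1≤x , ≤-refl , suffix-head sf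
    ...   | inj₂ (_ , refl) = 1≤x , <⇒≤ (∈⇒<bound st (here refl)) , fix (here refl)

    -- Entries decrease down the stack, so w hides m; since w still occurs at e, it remains on the
    -- stack when c is reached, and m cannot be read there.
    run-order : ∀ {h v S q w m c e} → Stack κ h v S → Suffix v q → Run S v q →
      w ∈ S → m ∈ S → m < w → v ≤ c → c < e → e ≤ n → at b c ≡ m → at b e ≡ w → ⊥
    run-order st sf stop w∈S m∈S m<w v≤c c<e e≤n bc be =
      suffix-empty sf v≤c (≤-trans (<⇒≤ c<e) e≤n)
    run-order {q = x ∷ q} st sf (s then R) w∈S m∈S m<w v≤c c<e e≤n refl refl with m≤n⇒m<n∨m≡n v≤c
    ... | inj₁ v<c = run-order (proj₂ (step-stack st s)) (suffix-tail sf) R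
            (step-∈⁺ s w∈S (∈-suffix⁺ q (suffix-tail sf) (<-trans v<c c<e) e≤n))
            (step-∈⁺ s m∈S (∈-suffix⁺ q (suffix-tail sf) v<c (≤-trans (<⇒≤ c<e) e≤n)))
            m<w v<c c<e e≤n refl refl
    ... | inj₂ refl rewrite suffix-head sf with step-current s
    ...   | inj₁ refl = <-irrefl refl (∈⇒<bound st m∈S)
    ...   | inj₂ (_ , refl) = <⇒≱ m<w (∈⇒≤head st w∈S)

    run⇒noncrossing : ∀ {h v S q} → Stack κ h v S → Suffix v q → Run S v q →
      ∀ a x c e → v ≤ x → at b a ≤ a → a < x → x < c → c < e → e ≤ n →
      at b a ≡ at b c → at b x ≡ at b e → at b a ≡ at b x
    run⇒noncrossing st sf stop a x c e v≤x _ a<x x<c c<e e≤n _ _ =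
      ⊥-elim (suffix-empty sf v≤x (≤-trans (<⇒≤ x<c) (≤-trans (<⇒≤ c<e) e≤n)))
    run⇒noncrossing {q = y ∷ q} st sf (s then R) a x c e v≤x ba≤a a<x x<c c<e e≤n a~c x~e
      with m≤n⇒m<n∨m≡n v≤x
    ... | inj₁ v<x = run⇒noncrossing (proj₂ (step-stack st s)) (suffix-tail sf) R
            a x c e v<x ba≤a a<x x<c c<e e≤n a~c x~e
    ... | inj₂ refl = a~x
      where
      st′ = proj₂ (step-stack st s)
      sf′ = suffix-tail sf
      bx∈q : at b x ∈ q
      bx∈q = subst (_∈ q) (sym x~e) (∈-suffix⁺ q sf′ (<-trans x<c c<e) e≤n)
      bc∈q : at b c ∈ q
      bc∈q = ∈-suffix⁺ q sf′ x<c (≤-trans (<⇒≤ c<e) e≤n)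
      -- `at b c` equals `at b a`, which is below x, so this block is older than x; as it recurs at
      -- c, it is on the stack after x.
      bc∈S′ = run-∈⁻ R bc∈q (subst (_< suc x) a~c (≤-<-trans ba≤a (m<n⇒m<1+n a<x)))
      top = step-current-∈ s (subst (_∈ q) (suffix-head sf) bx∈q)
      S′≡ = trans (proj₂ top) (cong (_∷ proj₁ top) (sym (suffix-head sf)))
      bx∈S′ = subst (at b x ∈_) (sym S′≡) (here refl)
      a~x : at b a ≡ at b x
      -- The block of x recurs at e and so is on top after x. A smaller `at b c` would be hidden
      -- below it until e, and a larger one would have to lie above the top.
      a~x with <-cmp (at b c) (at b x)
      ... | tri< bc<bx _ _ = ⊥-elim (run-order st′ sf′ R bx∈S′ bc∈S′ bc<bx x<c c<e e≤n refl (sym x~e))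
      ... | tri≈ _ bc≡bx _ = trans a~c bc≡bx
      ... | tri> _ _ bc>bx = ⊥-elim (<⇒≱ bc>bx
              (∈⇒≤head (subst (Stack κ _ (suc x)) S′≡ st′) (subst (at b c ∈_) S′≡ bc∈S′)))

    -- The last two hypotheses are the invariant: the stack entries above `κ` are exactly the block
    -- minima between `κ` and v that recur in `q`. Noncrossing then forces any old letter to be the
    -- top.
    noncrossing⇒run : ∀ {h v S q} → κ ≤ 1 → IsPartition n b → IsNoncrossing n b →
      Stack κ h v S → Suffix v q → Fixed S →
      (∀ {m} → m ∈ S → κ < m → m ∈ q) →
      (∀ {m} → κ < m → m < v → at b m ≡ m → m ∈ q → m ∈ S) → Run S v q
    noncrossing⇒run {q = []} κ≤1 part nc (bottom _) sf fix sound complete = stop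
    noncrossing⇒run {q = []} κ≤1 part nc (push _ st) sf fix sound complete
      with () ← sound (here refl) (κ<bound st)
    noncrossing⇒run {v = v} {S} {x ∷ q} κ≤1 part nc st sf fix sound complete with x ≟ v
    ... | yes refl = by (x ∈? q)
      where
      old : ∀ {m} → m ∈ S → κ < m → m ∈ q
      old m∈S κ<m with sound m∈S κ<m
      ... | here refl = ⊥-elim (<-irrefl refl (∈⇒<bound st m∈S))
      ... | there m∈q = m∈q
      earlier : ∀ {m} → κ < m → m < suc x → at b m ≡ m → m ∈ q → m ≡ x ⊎ m ∈ S
      earlier κ<m m<1+x bm≡m m∈q with m≤n⇒m<n∨m≡n (s≤s⁻¹ m<1+x)
      ... | inj₁ m<x = inj₂ (complete κ<m m<x bm≡m (there m∈q))
      ... | inj₂ m≡x = inj₁ m≡x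
      by : Dec (x ∈ q) → Run S x (x ∷ q)
      by (yes x∈q) = opens x∈q then noncrossing⇒run κ≤1 part nc (push ≤-refl st) (suffix-tail sf)
        (fixed-step sf fix (opens x∈q))
        (λ { (here refl) _ → x∈q ; (there m∈S) → old m∈S })
        (λ κ<m m< bm≡m m∈q → case (earlier κ<m m< bm≡m m∈q))
        where
        case : ∀ {m} → m ≡ x ⊎ m ∈ S → m ∈ x ∷ S
        case (inj₁ refl) = here refl
        case (inj₂ m∈S) = there m∈S
      by (no x∉q) = single x∉q then noncrossing⇒run κ≤1 part nc (raise (n≤1+n x) st) (suffix-tail sf) fix
        old (λ κ<m m< bm≡m m∈q → case m∈q (earlier κ<m m< bm≡m m∈q))
        where
        case : ∀ {m} → m ∈ q → m ≡ x ⊎ m ∈ S → m ∈ S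
        case m∈q (inj₁ refl) = ⊥-elim (x∉q m∈q)
        case m∈q (inj₂ m∈S) = m∈S
    ... | no x≢v = byStack st fix sound complete
      where
      1≤v = ≤-trans (s≤s z≤n) (κ<bound st)
      v≤n = suffix-≤ sf
      sf′ = suffix-tail sf
      bv≡x = suffix-head sf
      1≤x : 1 ≤ x
      1≤x = subst (1 ≤_) bv≡x (proj₁ (part v 1≤v v≤n))
      x<v : x < v
      x<v = ≤∧≢⇒< (subst (_≤ v) bv≡x (proj₁ (proj₂ (part v 1≤v v≤n)))) x≢v
      bx≡x : at b x ≡ x
      bx≡x = subst (λ w → at b w ≡ w) bv≡x (proj₂ (proj₂ (part v 1≤v v≤n)))
      κ<x : x ≢ κ → κ < x
      κ<x x≢κ = ≤∧≢⇒< (≤-trans κ≤1 1≤x) (λ κ≡x → x≢κ (sym κ≡x))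
      restrictComplete : ∀ {S} → (∀ {m} → κ < m → m < v → at b m ≡ m → m ∈ x ∷ q → m ∈ S) →
        ∀ {m} → κ < m → m < suc v → at b m ≡ m → m ∈ q → m ∈ S
      restrictComplete complete κ<m m<1+v bm≡m m∈q with m≤n⇒m<n∨m≡n (s≤s⁻¹ m<1+v)
      ... | inj₁ m<v = complete κ<m m<v bm≡m (there m∈q)
      ... | inj₂ refl = ⊥-elim (x≢v (trans (sym bv≡x) bm≡m))
      byStack : ∀ {h S} → Stack κ h v S → Fixed S → (∀ {m} → m ∈ S → κ < m → m ∈ x ∷ q) →
        (∀ {m} → κ < m → m < v → at b m ≡ m → m ∈ x ∷ q → m ∈ S) → Run S v (x ∷ q)
      byStack st@(bottom κ<v) fix sound complete = subst (λ u → Run (κ ∷ []) v (u ∷ q)) (sym x≡κ)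
        (keep-bottom (<⇒≢ κ<v) then noncrossing⇒run κ≤1 part nc (raise (n≤1+n v) st) sf′ fix
          (λ { (here refl) κ<κ → ⊥-elim (<-irrefl refl κ<κ) }) (restrictComplete complete))
        where
        x≡κ : x ≡ κ
        x≡κ with x ≟ κ
        ... | yes x≡κ = x≡κ
        ... | no x≢κ with complete (κ<x x≢κ) x<v bx≡x (here refl)
        ...   | here x≡κ = x≡κ
      byStack st@(push {m = m} {S = S} m<v st′) fix sound complete =
        subst (λ u → Run (m ∷ S) v (u ∷ q)) (sym x≡m) (by (m ∈? q))
        where
        κ<m = κ<bound st′
        x≡m : x ≡ m
        x≡m with <-cmp x m
        ... | tri≈ _ x≡m _ = x≡m
        -- The block x is still open, so by completeness it is on the stack, where no entry exceeds
        -- the top.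
        ... | tri> _ _ x>m = ⊥-elim (<⇒≱ x>m (∈⇒≤head st
                (complete (<-trans κ<m x>m) x<v bx≡x (here refl))))
        ... | tri< x<m _ _ with sound (here refl) κ<m
        ...   | here m≡x = sym m≡x
        -- Now x < m < v < c, where x and v share one block and m and c another, so noncrossing
        -- identifies the two.
        ...   | there m∈q with c , v<c , c≤n , bc≡m ← ∈-suffix⁻ q sf′ m∈q =
          trans (sym bx≡x) (trans (nc x m v c 1≤x x<m m<v v<c c≤n (trans bx≡x (sym bv≡x))
            (trans (fix (here refl)) (sym bc≡m))) (fix (here refl)))
        lower : m ∉ q → ∀ {m′} → m′ ∈ m ∷ S → m′ ∈ q → m′ ∈ S
        lower m∉q (here refl) m∈q = ⊥-elim (m∉q m∈q)
        lower m∉q (there m′∈S) _ = m′∈S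
        later : ∀ {m′} → m′ ∈ m ∷ S → κ < m′ → m′ ≡ m ⊎ m′ ∈ q
        later m′∈ κ<m′ with sound m′∈ κ<m′
        ... | here m′≡x = inj₁ (trans m′≡x x≡m)
        ... | there m′∈q = inj₂ m′∈q
        stay : m ∈ q → ∀ {m′} → m′ ≡ m ⊎ m′ ∈ q → m′ ∈ q
        stay m∈q (inj₁ refl) = m∈q
        stay m∈q (inj₂ m′∈q) = m′∈q
        below : ∀ {m′} → m′ ∈ S → m′ ≡ m ⊎ m′ ∈ q → m′ ∈ q
        below m′∈S (inj₁ refl) = ⊥-elim (<-irrefl refl (∈⇒<bound st′ m′∈S))
        below m′∈S (inj₂ m′∈q) = m′∈q
        by : Dec (m ∈ q) → Run (m ∷ S) v (m ∷ q)
        by (yes m∈q) = stays (<⇒≢ m<v) m∈q then noncrossing⇒run κ≤1 part nc (raise (n≤1+n v) st) sf′ fix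
          (λ m′∈ κ<m′ → stay m∈q (later m′∈ κ<m′)) (restrictComplete complete)
        by (no m∉q) = close-top st′ (<⇒≢ m<v) m∉q then noncrossing⇒run κ≤1 part nc
          (raise (m≤n⇒m≤1+n (<⇒≤ m<v)) st′) sf′ (λ m′∈S → fix (there m′∈S))
          (λ m′∈S κ<m′ → below m′∈S (later (there m′∈S) κ<m′))
          (λ κ<m′ m′< bm′ m′∈q → lower m∉q (restrictComplete complete κ<m′ m′< bm′ m′∈q) m′∈q)

-- The statistic as a product of local weights

if-^ : ∀ (p : Bool) y c → y ^ (if p then suc c else c) ≡ (if p then y else 1) * y ^ c
if-^ true y c = refl
if-^ false y c = sym (*-identityˡ _)

module _ (n i j : ℕ) where

  private
    d = suc n

  sWeight tWeight : ℕ → ℕ → ℕ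
  sWeight z v = if (v ≤ᵇ i) ∨ (d ∸ j ≤ᵇ v) then suc z else 1
  tWeight z v = if d ∸ j ≤ᵇ v then suc z else 1

  module _ (b : List ℕ) where

    open Suffix

    stat : ℕ
    stat = countB (special d i j b) (range1 n)

    module _ {v x q} (part : IsPartition n b) (1≤v : 1 ≤ v) (sf : Suffix n b v (x ∷ q)) where

      private
        bv≡x = suffix-head n b sf
        v≤n = suffix-≤ n b sf

        later-member : x ∈ q → ∃[ u ] u ∈ range1 n × v < u × at b u ≡ at b v
        later-member x∈q with u , v<u , u≤n , bu≡x ← ∈-suffix⁻ n b q (suffix-tail n b sf) x∈q =
          u , ∈-range1⁺ n (≤-trans 1≤v (<⇒≤ v<u)) u≤n , v<u , trans bu≡x (sym bv≡x)

        later-different : ∀ {u} → x ∉ q → u ∈ range1 n → v < u → at b u ≢ at b v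
        later-different x∉q u∈ v<u bu≡bv = x∉q (subst (_∈ q) (trans bu≡bv bv≡x)
          (∈-suffix⁺ n b q (suffix-tail n b sf) v<u (proj₂ (∈-range1⁻ n u∈))))

      isMin≡ : isMin b v ≡ does (x ≟ v)
      isMin≡ = cong (_≡ᵇ v) bv≡x

      same-1≡ : same b 1 v ≡ does (1 ≟ x)
      same-1≡ = cong₂ _≡ᵇ_ b1≡1 bv≡x
        where
        b1≡1 : at b 1 ≡ 1
        b1≡1 with 1≤b1 , b1≤1 , _ ← part 1 ≤-refl (≤-trans 1≤v v≤n) = ≤-antisym b1≤1 1≤b1

      isMax≡ : isMax n b v ≡ not (does (x ∈? q))
      isMax≡ = cong not (by (x ∈? q))
        where
        by : Dec (x ∈ q) → anyB (range1 n) (λ u → (v <ᵇ u) ∧ same b u v) ≡ does (x ∈? q)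
        by (yes x∈q) with u , u∈ , v<u , bu≡bv ← later-member x∈q =
          trans (anyB-true (range1 n) _ u∈ (cong₂ _∧_ (dec-true (v <? u) v<u)
                                                      (dec-true (at b u ≟ at b v) bu≡bv)))
                (sym (dec-true (x ∈? q) x∈q))
        by (no x∉q) = trans (anyB-false (range1 n) _ none) (sym (dec-false (x ∈? q) x∉q))
          where
          none : ∀ u → u ∈ range1 n → (v <ᵇ u) ∧ same b u v ≡ false
          none u u∈ = go (v <? u)
            where
            go : Dec (v < u) → (v <ᵇ u) ∧ same b u v ≡ false
            go (yes v<u) = trans (cong ((v <ᵇ u) ∧_)
              (dec-false (at b u ≟ at b v) (later-different x∉q u∈ v<u))) (∧-zeroʳ _)
            go (no v≮u) = cong (_∧ same b u v) (dec-false (v <? u) v≮u)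

      -- Since v is the minimum, every other member of its block comes later and shows up as a
      -- letter of `q`.
      nonSingleton-min : x ≡ v → nonSingleton n b v ≡ does (x ∈? q)
      nonSingleton-min x≡v = by (x ∈? q)
        where
        by : Dec (x ∈ q) → nonSingleton n b v ≡ does (x ∈? q)
        by (yes x∈q) with u , u∈ , v<u , bu≡bv ← later-member x∈q =
          trans (anyB-true (range1 n) _ u∈ (cong₂ _∧_
                  (cong not (dec-false (u ≟ v) (λ u≡v → <⇒≢ v<u (sym u≡v))))
                  (dec-true (at b u ≟ at b v) bu≡bv)))
                (sym (dec-true (x ∈? q) x∈q))
        by (no x∉q) = trans (anyB-false (range1 n) _ none) (sym (dec-false (x ∈? q) x∉q))
          where
          none : ∀ u → u ∈ range1 n → not (u ≡ᵇ v) ∧ same b u v ≡ false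
          none u u∈ = go (u ≟ v)
            where
            different : u ≢ v → at b u ≢ at b v
            different u≢v bu≡bv = later-different x∉q u∈ (≤∧≢⇒< v≤u (λ v≡u → u≢v (sym v≡u))) bu≡bv
              where
              v≤u : v ≤ u
              v≤u = subst (_≤ u) (trans bu≡bv (trans bv≡x x≡v))
                (proj₁ (proj₂ (part u (proj₁ (∈-range1⁻ n u∈)) (proj₂ (∈-range1⁻ n u∈)))))
            go : Dec (u ≡ v) → not (u ≡ᵇ v) ∧ same b u v ≡ false
            go (yes u≡v) = cong (λ p → not p ∧ same b u v) (dec-true (u ≟ v) u≡v)
            go (no u≢v) = trans (cong (not (u ≡ᵇ v) ∧_)
              (dec-false (at b u ≟ at b v) (different u≢v))) (∧-zeroʳ _)

      nonSingleton-nonmin : x ≢ v → nonSingleton n b v ≡ true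
      nonSingleton-nonmin x≢v = anyB-true (range1 n) _ (∈-range1⁺ n 1≤x x≤n)
        (cong₂ _∧_ (cong not (dec-false (x ≟ v) x≢v)) (dec-true (at b x ≟ at b v) bx≡bv))
        where
        1≤x = subst (1 ≤_) bv≡x (proj₁ (part v 1≤v v≤n))
        x≤n = ≤-trans (subst (_≤ v) bv≡x (proj₁ (proj₂ (part v 1≤v v≤n)))) v≤n
        bx≡bv = trans (cong (at b) (sym bv≡x)) (proj₂ (proj₂ (part v 1≤v v≤n)))

      module _ {κ : ℕ} (z : ℕ) (bottom-block : κ ≡ 1 ⊎ (κ ≡ 0 × j ≡ 0)) where

        -- The one clause that refers to another block asks whether a maximum lies in the block of
        -- 1. If κ = 1, this is the test `x ≟ κ` in `weightAt`; if j = 0, the threshold is d, beyond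
        -- every position, so the clause never applies.
        special-weight : (if special d i j b v then suc z else 1)
          ≡ Weights.weightAt κ z (sWeight z) (tWeight z) v x (does (x ∈? q))
        special-weight = by (x ≟ v)
          where
          early = v ≤ᵇ i
          late = d ∸ j ≤ᵇ v
          goal : Bool → Bool → Bool → Bool → Set
          goal min nonsing max first =
            (if (min ∧ nonsing) ∨ (not nonsing ∧ (early ∨ late)) ∨ (late ∧ not min ∧ (not max ∨ first))
             then suc z else 1)
            ≡ Weights.weightAt κ z (sWeight z) (tWeight z) v x (does (x ∈? q))
          transport : ∀ {m₁ m₂ n₁ n₂ x₁ x₂ f₁ f₂} → m₁ ≡ m₂ → n₁ ≡ n₂ → x₁ ≡ x₂ → f₁ ≡ f₂ →
            goal m₂ n₂ x₂ f₂ → goal m₁ n₁ x₁ f₁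
          transport refl refl refl refl g = g
          minimum : x ≡ v → ∀ l → (if (true ∧ l) ∨ (not l ∧ (early ∨ late)) ∨ (late ∧ false)
            then suc z else 1) ≡ Weights.weightAt κ z (sWeight z) (tWeight z) v x l
          minimum x≡v true rewrite dec-true (x ≟ v) x≡v = refl
          minimum x≡v false rewrite dec-true (x ≟ v) x≡v with early | late
          ... | true | _ = refl
          ... | false | true = refl
          ... | false | false = refl
          not-late : κ ≡ 0 × j ≡ 0 → late ≡ false
          not-late (_ , refl) = dec-false (d ≤? v) (<⇒≱ (s≤s v≤n))
          other : x ≢ v → ∀ l → (if late ∧ (not (not l) ∨ does (1 ≟ x)) then suc z else 1)
            ≡ Weights.weightAt κ z (sWeight z) (tWeight z) v x l
          other x≢v true rewrite dec-false (x ≟ v) x≢v with late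
          ... | true = refl
          ... | false = refl
          other x≢v false rewrite dec-false (x ≟ v) x≢v = last bottom-block (x ≟ κ)
            where
            last : κ ≡ 1 ⊎ (κ ≡ 0 × j ≡ 0) → Dec (x ≡ κ) →
              (if late ∧ does (1 ≟ x) then suc z else 1) ≡ (if does (x ≟ κ) then tWeight z v else 1)
            last (inj₁ refl) (yes x≡1) rewrite dec-true (x ≟ 1) x≡1 | dec-true (1 ≟ x) (sym x≡1)
              with late
            ... | true = refl
            ... | false = refl
            last (inj₁ refl) (no x≢1) rewrite dec-false (x ≟ 1) x≢1
              | dec-false (1 ≟ x) (λ 1≡x → x≢1 (sym 1≡x)) with late
            ... | true = refl
            ... | false = refl
            last (inj₂ κ≡0) _ rewrite not-late κ≡0 with does (x ≟ κ)
            ... | true = refl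
            ... | false = refl
          by : Dec (x ≡ v) → (if special d i j b v then suc z else 1)
            ≡ Weights.weightAt κ z (sWeight z) (tWeight z) v x (does (x ∈? q))
          by (yes x≡v) = transport (trans isMin≡ (dec-true (x ≟ v) x≡v)) (nonSingleton-min x≡v)
            (refl {x = isMax n b v}) (refl {x = same b 1 v}) (minimum x≡v (does (x ∈? q)))
          by (no x≢v) = transport (trans isMin≡ (dec-false (x ≟ v) x≢v)) (nonSingleton-nonmin x≢v)
            isMax≡ same-1≡ (other x≢v (does (x ∈? q)))

    weight≡special : ∀ {κ v q} z → κ ≡ 1 ⊎ (κ ≡ 0 × j ≡ 0) → IsPartition n b → 1 ≤ v → Suffix n b v q →
      suc z ^ countB (special d i j b) (interval v (length q))
        ≡ Weights.weight κ z (sWeight z) (tWeight z) v q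
    weight≡special {q = []} z bottom-block part 1≤v sf = refl
    weight≡special {v = v} {x ∷ q} z bottom-block part 1≤v sf = trans
      (if-^ (special d i j b v) (suc z) _)
      (cong₂ _*_ (special-weight part 1≤v sf z bottom-block)
        (weight≡special z bottom-block part (m≤n⇒m≤1+n 1≤v) (suffix-tail n b sf)))

    valid : Bool
    valid = isPartition n b ∧ isNoncrossing n b

    -- For κ = 1 the hypothesis `at b κ ≡ κ` says that the word starts with 1, and `q` is the rest
    -- of it. For κ = 0 it is the default value of `at` at position 0, and `q` is the whole word.
    valid≡run : ∀ {κ q} → κ ≤ 1 → at b κ ≡ κ → Suffix n b (suc κ) q → All (1 ≤_) q →
      valid ≡ does (run? (κ ∷ []) (suc κ) q)
    valid≡run {κ} {q} κ≤1 bκ≡κ sf pos = by (run? (κ ∷ []) (suc κ) q)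
      where
      st : Stack κ 0 (suc κ) (κ ∷ [])
      st = bottom ≤-refl
      fix : Fixed n b (κ ∷ [])
      fix (here refl) = bκ≡κ
      complete : T valid → Run (κ ∷ []) (suc κ) q
      complete p with p₁ , p₂ ← T-∧⁻ {isPartition n b} p =
        noncrossing⇒run n b κ≤1 (isPartition⁻ n b p₁) (isNoncrossing⁻ n b p₂) st sf fix
          (λ { (here refl) κ<κ → ⊥-elim (<-irrefl refl κ<κ) })
          (λ κ<m m<1+κ _ _ → ⊥-elim (<⇒≱ κ<m (s≤s⁻¹ m<1+κ)))
      sound : Run (κ ∷ []) (suc κ) q → T valid
      sound R = T-∧⁺ (isPartition⁺ n b part) (isNoncrossing⁺ n b nc)
        where
        part : IsPartition n b
        part u 1≤u u≤n with suc κ ≤? u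
        ... | yes κ<u = run⇒partition n b st sf pos fix R u κ<u u≤n
        ... | no κ≮u with refl ← ≤-antisym (≮⇒≥ κ≮u) (≤-trans κ≤1 1≤u) =
          subst (1 ≤_) (sym bκ≡κ) 1≤u , ≤-reflexive bκ≡κ , cong (at b) bκ≡κ
        nc : IsNoncrossing n b
        nc a x c e 1≤a a<x x<c c<e e≤n = run⇒noncrossing n b st sf R a x c e
          (≤-<-trans (≤-trans κ≤1 1≤a) a<x)
          (proj₁ (proj₂ (part a 1≤a (<⇒≤ (<-trans a<x (<-trans x<c (<-≤-trans c<e e≤n)))))))
          a<x x<c c<e e≤n
      by : Dec (Run (κ ∷ []) (suc κ) q) → valid ≡ does (run? (κ ∷ []) (suc κ) q)
      by (yes R) = trans (Equivalence.to T-≡ (sound R)) (sym (dec-true (run? (κ ∷ []) (suc κ) q) R))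
      by (no ¬R) = trans (¬T⇒false (λ p → ¬R (complete p)))
                         (sym (dec-false (run? (κ ∷ []) (suc κ) q) ¬R))
        where
        ¬T⇒false : ∀ {p} → ¬ T p → p ≡ false
        ¬T⇒false {true} ¬p = ⊥-elim (¬p tt)
        ¬T⇒false {false} ¬p = refl

  statWeight : ℕ → List ℕ → ℕ
  statWeight z b = if valid b then suc z ^ stat b else 0

  statWeight-run : ∀ {P : Set} z b w (run : Dec P) → valid b ≡ does run →
    (IsPartition n b → suc z ^ stat b ≡ w) → statWeight z b ≡ restrict run w
  statWeight-run z b w run valid≡ power rewrite sym valid≡ = by (valid b) refl
    where
    by : ∀ p → valid b ≡ p → (if p then suc z ^ stat b else 0) ≡ (if p then w else 0)
    by false _ = refl
    by true valid≡true =
      power (isPartition⁻ n b (proj₁ (T-∧⁻ (Equivalence.from T-≡ valid≡true))))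


-- Summing the statistic over all noncrossing partitions

module _ (z : ℕ) (s t : ℕ → ℕ) where

  open Weights using (walk)

  -- With level weight 1 at height 0 and 2 above, the piece at height 0 has series A and each of the
  -- h pieces above it has series G, which gives u^h A G^h.
  walk-closed : ∀ n → (∀ v → 1 ≤ v → v ≤ n → s v ≡ 1 × t v ≡ 1) →
    ∀ r h v → 1 ≤ v → v + r ≡ suc n → walk 0 z s t h v r ≡ cfrac z h (suc h) (2 + r ∸ h)
  walk-closed n one zero zero v _ _ rewrite *-zeroʳ z = refl
  walk-closed n one zero (suc zero) v _ _ = sym (cfrac-1 z 1 2)
  walk-closed n one zero (suc (suc h)) v _ _ = sym (cong (cfrac z (2 + h) (3 + h)) (0∸n≡0 h))
  walk-closed n one (suc r) h v 1≤v v+r≡ = go h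
    where
    v+r≡′ : suc v + r ≡ suc n
    v+r≡′ = trans (sym (+-suc v r)) v+r≡
    v≤n : v ≤ n
    v≤n = s≤s⁻¹ (subst (suc v ≤_) v+r≡′ (m≤m+n (suc v) r))
    rest : ∀ h → walk 0 z s t h (suc v) r ≡ cfrac z h (suc h) (2 + r ∸ h)
    rest h = walk-closed n one r h (suc v) (m≤n⇒m≤1+n 1≤v) v+r≡′
    go : ∀ h → walk 0 z s t h v (suc r) ≡ cfrac z h (suc h) (3 + r ∸ h)
    go zero rewrite proj₁ (one v 1≤v v≤n) | rest 1 | rest 0 = begin
      suc z * cfrac z 1 2 (suc r) + 1 * cpow z 1 (2 + r)
        ≡⟨ arith z (cfrac z 1 2 (suc r)) (cpow z 1 (2 + r)) ⟩
      cpow z 1 (2 + r) + cfrac z 1 2 (suc r) + z * cfrac z 1 2 (suc r)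
        ≡⟨ sym (cfrac-rec z 0 0 (suc r)) ⟩
      cpow z 1 (3 + r) ∎
      where
      open ≡-Reasoning
      arith : ∀ z a c → suc z * a + 1 * c ≡ c + a + z * a
      arith = solve-∀
    go (suc h) rewrite proj₁ (one v 1≤v v≤n) | proj₂ (one v 1≤v v≤n)
      | rest (2 + h) | rest (suc h) | rest h =
      sym (trans (cfrac-motzkin z h (suc h) (2 + r ∸ h))
        (cong₂ (λ a b → suc z * cfrac z (2 + h) (3 + h) a + 2 * cfrac z (suc h) (2 + h) b
                        + cfrac z h (suc h) (2 + r ∸ h))
          (trans (∸-+-assoc (2 + r) h 2) (cong (2 + r ∸_) (+-comm h 2)))
          (trans (∸-+-assoc (2 + r) h 1) (cong (2 + r ∸_) (+-comm h 1)))))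

  -- For κ = 1 the bottom block supplies the second kind of level step at height 0, so the level
  -- weight no longer depends on the height.
  walk≡motzkin : ∀ r h v → walk 1 z s t h v r ≡ motzkin z h (map (λ u → s u + t u) (interval v r))
  walk≡motzkin zero zero v = refl
  walk≡motzkin zero (suc h) v = refl
  walk≡motzkin (suc r) zero v rewrite walk≡motzkin r 1 (suc v) | walk≡motzkin r 0 (suc v)
    | *-identityˡ (t v) = refl
  walk≡motzkin (suc r) (suc h) v rewrite walk≡motzkin r (2 + h) (suc v)
    | walk≡motzkin r (suc h) (suc v) | walk≡motzkin r h (suc v) = refl

interval-++ : ∀ v a c → interval v (a + c) ≡ interval v a ++ interval (v + a) c
interval-++ v zero c = cong (λ u → interval u c) (sym (+-identityʳ v))
interval-++ v (suc a) c = cong (v ∷_) (trans (interval-++ (suc v) a c)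
  (cong (λ u → interval (suc v) a ++ interval u c) (sym (+-suc v a))))

map-interval-const : ∀ (f : ℕ → ℕ) c v r → (∀ u → v ≤ u → u < v + r → f u ≡ c) →
  map f (interval v r) ≡ replicate r c
map-interval-const f c v zero f≡c = refl
map-interval-const f c v (suc r) f≡c = cong₂ _∷_ (f≡c v ≤-refl (m<m+n v z<s))
  (map-interval-const f c (suc v) r (λ u v<u u< →
    f≡c u (<⇒≤ v<u) (subst (u <_) (sym (+-suc v r)) u<)))

module _ (z a q j : ℕ) where

  private
    n = suc a + q + j
    s = sWeight n (suc a) j z
    t = tWeight n (suc a) j z

  -- Position 1 is left out because it opens the bottom block. With i = a + 1 and n = i + q + j, the
  -- conditions v ≤ i and v ≥ d - j cut the other positions into pieces of lengths a, q and j.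
  levels≡map : map (λ u → s u + t u) (interval 2 (a + q + j)) ≡ levels z a q j
  levels≡map = begin
    map f (interval 2 (a + q + j))
      ≡⟨ cong (λ r → map f (interval 2 r)) (+-assoc a q j) ⟩
    map f (interval 2 (a + (q + j)))
      ≡⟨ cong (map f) (trans (interval-++ 2 a (q + j))
           (cong (interval 2 a ++_) (interval-++ (2 + a) q j))) ⟩
    map f (interval 2 a ++ interval (2 + a) q ++ interval (2 + a + q) j)
      ≡⟨ trans (map-++ f (interval 2 a) _)
           (cong (map f (interval 2 a) ++_) (map-++ f (interval (2 + a) q) _)) ⟩
    map f (interval 2 a) ++ map f (interval (2 + a) q) ++ map f (interval (2 + a + q) j)
      ≡⟨ cong₂ _++_ (map-interval-const f (2 + z) 2 a left)
           (cong₂ _++_ (map-interval-const f 2 (2 + a) q middle)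
                       (map-interval-const f (2 + (z + z)) (2 + a + q) j right)) ⟩
    levels z a q j ∎
    where
    open ≡-Reasoning
    f : ℕ → ℕ
    f u = s u + t u
    cut : suc n ∸ j ≡ 2 + a + q
    cut = m+n∸n≡m (2 + a + q) j
    early : ∀ {u} → u ≤ suc a → (u ≤ᵇ suc a) ≡ true
    early {u} u≤ = dec-true (u ≤? suc a) u≤
    not-early : ∀ {u} → suc a < u → (u ≤ᵇ suc a) ≡ false
    not-early {u} <u = dec-false (u ≤? suc a) (<⇒≱ <u)
    late : ∀ {u} → 2 + a + q ≤ u → (suc n ∸ j ≤ᵇ u) ≡ true
    late {u} ≤u = trans (cong (_≤ᵇ u) cut) (dec-true (2 + a + q ≤? u) ≤u)
    not-late : ∀ {u} → u < 2 + a + q → (suc n ∸ j ≤ᵇ u) ≡ false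
    not-late {u} u< = trans (cong (_≤ᵇ u) cut) (dec-false (2 + a + q ≤? u) (<⇒≱ u<))
    left : ∀ u → 2 ≤ u → u < 2 + a → f u ≡ 2 + z
    left u _ u< rewrite early (s≤s⁻¹ u<) | not-late (<-≤-trans u< (m≤m+n (2 + a) q)) = +-comm (suc z) 1
    middle : ∀ u → 2 + a ≤ u → u < 2 + a + q → f u ≡ 2
    middle u ≤u u< rewrite not-early ≤u | not-late u< = refl
    right : ∀ u → 2 + a + q ≤ u → u < 2 + a + q + j → f u ≡ 2 + (z + z)
    right u ≤u _ rewrite not-early (≤-trans (m≤m+n (2 + a) q) ≤u) | late ≤u = cong suc (+-suc z z)

  private
    r = a + q + j

  statWeight-first : ∀ x p → length p ≡ r → All (1 ≤_) p → 1 ≤ x →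
    statWeight n (suc a) j z (x ∷ p)
      ≡ restrict (x ≟ 1) (suc z * Weights.runWeight 1 z s t (1 ∷ []) 2 p)
  statWeight-first x p ∣p∣ pos 1≤x = by (x ≟ 1)
    where
    b = x ∷ p
    by : Dec (x ≡ 1) → statWeight n (suc a) j z b
      ≡ restrict (x ≟ 1) (suc z * Weights.runWeight 1 z s t (1 ∷ []) 2 p)
    by (no x≢1) = trans
      (cong (λ v → if v then suc z ^ stat n (suc a) j b else 0) (invalid (valid n (suc a) j b) refl))
                        (sym (restrict-no (x ≟ 1) _ x≢1))
      where
      invalid : ∀ v → valid n (suc a) j b ≡ v → valid n (suc a) j b ≡ false
      invalid false eq = eq
      invalid true eq = ⊥-elim (x≢1 (≤-antisym
        (proj₁ (proj₂ (isPartition⁻ n b (proj₁ (T-∧⁻ (Equivalence.from T-≡ eq))) 1 ≤-refl (s≤s z≤n)))) 1≤x))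
    by (yes refl) = begin
      statWeight n (suc a) j z b
        ≡⟨ statWeight-run n (suc a) j z b _ d (valid≡run n (suc a) j b ≤-refl refl sf pos) power ⟩
      restrict d (suc z * Weights.weight 1 z s t 2 p)
        ≡⟨ restrict-* d (suc z) (Weights.weight 1 z s t 2 p) ⟩
      suc z * Weights.runWeight 1 z s t (1 ∷ []) 2 p ∎
      where
      open ≡-Reasoning
      d = run? (1 ∷ []) 2 p
      sf : Suffix n b 2 p
      sf = record { letter = λ k → refl ; extent = cong (λ l → 2 + l) ∣p∣ }
      -- Element 1 is special in either case: as the minimum of a larger block, or as a singleton
      -- with 1 ≤ i.
      first : special (suc n) (suc a) j b 1 ≡ true
      first with nonSingleton n b 1
      ... | true = refl
      ... | false = refl
      power : IsPartition n b → suc z ^ stat n (suc a) j b ≡ suc z * Weights.weight 1 z s t 2 p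
      power part = begin
        suc z ^ countB (special (suc n) (suc a) j b) (range1 n)
          ≡⟨ cong (λ xs → suc z ^ countB (special (suc n) (suc a) j b) xs) (range1≡interval n) ⟩
        suc z ^ countB (special (suc n) (suc a) j b) (interval 1 n)
          ≡⟨ if-^ (special (suc n) (suc a) j b 1) (suc z) _ ⟩
        (if special (suc n) (suc a) j b 1 then suc z else 1)
          * suc z ^ countB (special (suc n) (suc a) j b) (interval 2 r)
          ≡⟨ cong₂ (λ c l → (if c then suc z else 1)
               * suc z ^ countB (special (suc n) (suc a) j b) (interval 2 l)) first (sym ∣p∣) ⟩
        suc z * suc z ^ countB (special (suc n) (suc a) j b) (interval 2 (length p))
          ≡⟨ cong (suc z *_) (weight≡special n (suc a) j b z (inj₁ refl) part (s≤s z≤n) sf) ⟩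
        suc z * Weights.weight 1 z s t 2 p ∎

  statWeight-sum-positive : listSum (statWeight n (suc a) j z) (lists n n) ≡ closed z n (suc a) j
  statWeight-sum-positive = begin
    listSum (statWeight n (suc a) j z) (lists n n)
      ≡⟨ listSum-lists n r (statWeight n (suc a) j z) ⟩
    listSum (λ x → listSum (λ p → statWeight n (suc a) j z (x ∷ p)) (lists n r)) (range1 n)
      ≡⟨ listSum-range1-cong n (λ x 1≤x _ → trans
           (listSum-lists-cong n r (λ p ∣p∣ pos → statWeight-first x p ∣p∣ pos 1≤x))
           (listSum-restrict (x ≟ 1) (λ p → suc z * Weights.runWeight 1 z s t (1 ∷ []) 2 p) (lists n r))) ⟩
    listSum (λ x → restrict (x ≟ 1)
      (listSum (λ p → suc z * Weights.runWeight 1 z s t (1 ∷ []) 2 p) (lists n r))) (range1 n)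
      ≡⟨ listSum-range1-one n 1 _ ≤-refl (s≤s z≤n) ⟩
    listSum (λ p → suc z * Weights.runWeight 1 z s t (1 ∷ []) 2 p) (lists n r)
      ≡⟨ listSum-* (suc z) (Weights.runWeight 1 z s t (1 ∷ []) 2) (lists n r) ⟩
    suc z * Weights.totalWeight 1 z s t n ≤-refl (1 ∷ []) 2 r
      ≡⟨ cong (suc z *_) (Weights.totalWeight≡walk 1 z s t n ≤-refl 2 r (bottom ≤-refl) refl) ⟩
    suc z * Weights.walk 1 z s t 0 2 r
      ≡⟨ cong (suc z *_) (walk≡motzkin z s t r 0 2) ⟩
    suc z * motzkin z 0 (map (λ u → s u + t u) (interval 2 r))
      ≡⟨ cong (λ ls → suc z * motzkin z 0 ls) levels≡map ⟩
    suc z * motzkin z 0 (levels z a q j)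
      ≡⟨ levels-closed z j a q ⟩
    closed z n (suc a) j ∎
    where
    open ≡-Reasoning
    listSum-restrict : ∀ {P A : Set} (d : Dec P) (f : A → ℕ) xs →
      listSum (λ x → restrict d (f x)) xs ≡ restrict d (listSum f xs)
    listSum-restrict (yes _) f xs = refl
    listSum-restrict (no _) f xs = listSum-zero _ xs (λ _ → refl)

statWeight-sum-zero : ∀ z n → listSum (statWeight n 0 0 z) (lists n n) ≡ closed z n 0 0
statWeight-sum-zero z n = begin
  listSum (statWeight n 0 0 z) (lists n n)
    ≡⟨ listSum-lists-cong n n same-weight ⟩
  Weights.totalWeight 0 z s t n z≤n (0 ∷ []) 1 n
    ≡⟨ Weights.totalWeight≡walk 0 z s t n z≤n 1 n (bottom ≤-refl) refl ⟩
  Weights.walk 0 z s t 0 1 n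
    ≡⟨ walk-closed z s t n ones n 0 1 ≤-refl refl ⟩
  cpow z 1 (2 + n)
    ≡⟨ sym (closed-00 z n) ⟩
  closed z n 0 0 ∎
  where
  open ≡-Reasoning
  s = sWeight n 0 0 z
  t = tWeight n 0 0 z
  ones : ∀ v → 1 ≤ v → v ≤ n → s v ≡ 1 × t v ≡ 1
  ones v 1≤v v≤n rewrite dec-false (v ≤? 0) (<⇒≱ 1≤v) | dec-false (suc n ≤? v) (<⇒≱ (s≤s v≤n)) = refl , refl
  same-weight : ∀ b → length b ≡ n → All (1 ≤_) b →
    statWeight n 0 0 z b ≡ Weights.runWeight 0 z s t (0 ∷ []) 1 b
  same-weight b ∣b∣ pos = statWeight-run n 0 0 z b _ (run? (0 ∷ []) 1 b)
    (valid≡run n 0 0 b z≤n (at-0 b) sf pos)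
    (λ part → trans
      (cong (λ xs → suc z ^ countB (special (suc n) 0 0 b) xs)
        (trans (range1≡interval n) (cong (interval 1) (sym ∣b∣))))
      (weight≡special n 0 0 b z (inj₂ (refl , refl)) part ≤-refl sf))
    where
    sf : Suffix n b 1 b
    sf = record { letter = λ k → refl ; extent = cong suc ∣b∣ }
    at-0 : ∀ b → at b 0 ≡ 0
    at-0 [] = refl
    at-0 (x ∷ b) = refl

statWeight-sum : ∀ z n i j → (i ≡ 0 × j ≡ 0) ⊎ (1 ≤ i × i + j ≤ n) →
  listSum (statWeight n i j z) (lists n n) ≡ closed z n i j
statWeight-sum z n i j (inj₁ (refl , refl)) = statWeight-sum-zero z n
statWeight-sum z n (suc a) j (inj₂ (_ , i+j≤n)) =
  subst (λ n → listSum (statWeight n (suc a) j z) (lists n n) ≡ closed z n (suc a) j)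
    size (statWeight-sum-positive z a (n ∸ (suc a + j)) j)
  where
  size : suc a + (n ∸ (suc a + j)) + j ≡ n
  size = trans (arith (suc a) (n ∸ (suc a + j)) j) (m∸n+n≡m i+j≤n)
    where
    arith : ∀ i q j → i + q + j ≡ q + (i + j)
    arith = solve-∀

-- Comparing coefficients

open import Data.Integer as ℤ using (ℤ; +_; _-_)
import Data.Integer.Properties as ℤₚ
import Data.Integer.Tactic.RingSolver as ℤ-Solver

coeff-⊕ : ∀ p q t → coeff (p ⊕ q) t ≡ coeff p t ℤ.+ coeff q t
coeff-⊕ [] q t = sym (ℤₚ.+-identityˡ _)
coeff-⊕ (a ∷ p) [] t = sym (ℤₚ.+-identityʳ _)
coeff-⊕ (a ∷ p) (b ∷ q) zero = refl
coeff-⊕ (a ∷ p) (b ∷ q) (suc t) = coeff-⊕ p q t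

coeff-scale : ∀ c p t → coeff (scale c p) t ≡ c ℤ.* coeff p t
coeff-scale c [] t = sym (ℤₚ.*-zeroʳ c)
coeff-scale c (a ∷ p) zero = refl
coeff-scale c (a ∷ p) (suc t) = coeff-scale c p t

coeff-⊗-one : ∀ p t → coeff (p ⊗ one) t ≡ coeff p t
coeff-⊗-one [] t = refl
coeff-⊗-one (a ∷ p) zero = trans (ℤₚ.+-identityʳ _) (ℤₚ.*-identityʳ a)
coeff-⊗-one (a ∷ p) (suc t) = coeff-⊗-one p t

coeff-⊗-xPow-zero : ∀ p e → coeff (p ⊗ xPow (suc e)) 0 ≡ + 0
coeff-⊗-xPow-zero [] e = refl
coeff-⊗-xPow-zero (a ∷ p) e = trans (ℤₚ.+-identityʳ _) (ℤₚ.*-zeroʳ a)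

coeff-⊗-xPow-suc : ∀ p e t → coeff (p ⊗ xPow (suc e)) (suc t) ≡ coeff (p ⊗ xPow e) t
coeff-⊗-xPow-suc [] e t = refl
coeff-⊗-xPow-suc (a ∷ p) e t = trans (coeff-⊕ (scale a (xPow e)) (p ⊗ xPow (suc e)) t)
  (trans (cong (ℤ._+_ (coeff (scale a (xPow e)) t)) (tail t))
         (sym (coeff-⊕ (scale a (xPow e)) (+ 0 ∷ (p ⊗ xPow e)) t)))
  where
  tail : ∀ t → coeff (p ⊗ xPow (suc e)) t ≡ coeff (+ 0 ∷ (p ⊗ xPow e)) t
  tail zero = coeff-⊗-xPow-zero p e
  tail (suc t) = coeff-⊗-xPow-suc p e t

coeff-oneMinusX-suc : ∀ p t → coeff (oneMinusX ⊗ p) (suc t) ≡ coeff p (suc t) - coeff p t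
coeff-oneMinusX-suc p t = begin
  coeff (oneMinusX ⊗ p) (suc t)
    ≡⟨ coeff-⊕ (scale (+ 1) p) _ (suc t) ⟩
  coeff (scale (+ 1) p) (suc t) ℤ.+ coeff (scale ℤ.-1ℤ p ⊕ (+ 0 ∷ [])) t
    ≡⟨ cong₂ ℤ._+_ (trans (coeff-scale (+ 1) p (suc t)) (ℤₚ.*-identityˡ _))
         (trans (coeff-⊕ (scale ℤ.-1ℤ p) (+ 0 ∷ []) t)
           (trans (cong₂ ℤ._+_ (trans (coeff-scale ℤ.-1ℤ p t) (ℤₚ.-1*i≡-i _)) (zeros t))
                  (ℤₚ.+-identityʳ _))) ⟩
  coeff p (suc t) - coeff p t ∎
  where
  open ≡-Reasoning
  zeros : ∀ t → coeff (+ 0 ∷ []) t ≡ + 0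
  zeros zero = refl
  zeros (suc t) = refl

coeff-oneMinusX-zero : ∀ p → coeff (oneMinusX ⊗ p) 0 ≡ coeff p 0
coeff-oneMinusX-zero p = trans (coeff-⊕ (scale (+ 1) p) _ 0)
  (trans (ℤₚ.+-identityʳ _) (trans (coeff-scale (+ 1) p 0) (ℤₚ.*-identityˡ _)))

coeff-pPow-degree : ∀ k t → k < t → coeff (pPow oneMinusX k) t ≡ + 0
coeff-pPow-degree zero (suc t) _ = refl
coeff-pPow-degree (suc k) (suc t) (s≤s k<t) = trans (coeff-oneMinusX-suc (pPow oneMinusX k) t)
  (cong₂ _-_ (coeff-pPow-degree k (suc t) (m<n⇒m<1+n k<t)) (coeff-pPow-degree k t k<t))

-- Evaluating the reversed polynomial

module _ (y : ℤ) where

  horner : ℕ → (ℕ → ℤ) → ℤ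
  horner zero a = a 0
  horner (suc D) a = a 0 ℤ.+ y ℤ.* horner D (a ∘ suc)

  -- y^D p(1/y) for a polynomial p of degree at most D.
  reverseEval : ℕ → Poly → ℤ
  reverseEval D p = horner D (λ m → coeff p (D ∸ m))

  horner-cong : ∀ D {a b : ℕ → ℤ} → (∀ m → m ≤ D → a m ≡ b m) → horner D a ≡ horner D b
  horner-cong zero a≗b = a≗b 0 z≤n
  horner-cong (suc D) a≗b =
    cong₂ (λ u v → u ℤ.+ y ℤ.* v) (a≗b 0 z≤n) (horner-cong D (λ m m≤D → a≗b (suc m) (s≤s m≤D)))

  horner-+ : ∀ D a b → horner D (λ m → a m ℤ.+ b m) ≡ horner D a ℤ.+ horner D b
  horner-+ zero a b = refl
  horner-+ (suc D) a b rewrite horner-+ D (a ∘ suc) (b ∘ suc) =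
    arith (a 0) (b 0) y (horner D (a ∘ suc)) (horner D (b ∘ suc))
    where
    arith : ∀ a b y u v → a ℤ.+ b ℤ.+ y ℤ.* (u ℤ.+ v) ≡ a ℤ.+ y ℤ.* u ℤ.+ (b ℤ.+ y ℤ.* v)
    arith = ℤ-Solver.solve-∀

  horner-* : ∀ D c a → horner D (λ m → c ℤ.* a m) ≡ c ℤ.* horner D a
  horner-* zero c a = refl
  horner-* (suc D) c a rewrite horner-* D c (a ∘ suc) = arith c (a 0) y (horner D (a ∘ suc))
    where
    arith : ∀ c a y u → c ℤ.* a ℤ.+ y ℤ.* (c ℤ.* u) ≡ c ℤ.* (a ℤ.+ y ℤ.* u)
    arith = ℤ-Solver.solve-∀

  horner-zero : ∀ D → horner D (λ _ → + 0) ≡ + 0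
  horner-zero zero = refl
  horner-zero (suc D) rewrite horner-zero D = trans (ℤₚ.+-identityˡ _) (ℤₚ.*-zeroʳ y)

  reverseEval-cong : ∀ D p q → (∀ t → coeff p t ≡ coeff q t) → reverseEval D p ≡ reverseEval D q
  reverseEval-cong D p q p≗q = horner-cong D (λ m _ → p≗q (D ∸ m))

  reverseEval-⊕ : ∀ D p q → reverseEval D (p ⊕ q) ≡ reverseEval D p ℤ.+ reverseEval D q
  reverseEval-⊕ D p q = trans (horner-cong D (λ m _ → coeff-⊕ p q (D ∸ m))) (horner-+ D _ _)

  reverseEval-scale : ∀ D c p → reverseEval D (scale c p) ≡ c ℤ.* reverseEval D p
  reverseEval-scale D c p = trans (horner-cong D (λ m _ → coeff-scale c p (D ∸ m))) (horner-* D c _)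

  -- Here `q` is x p, and the factor 1/y that x becomes is absorbed by the additional power of y.
  reverseEval-shift : ∀ D p q → coeff q 0 ≡ + 0 → (∀ t → coeff q (suc t) ≡ coeff p t) →
    reverseEval (suc D) q ≡ reverseEval D p
  reverseEval-shift zero p q q0 qs = trans (cong₂ (λ u v → u ℤ.+ y ℤ.* v) (qs 0) q0)
    (trans (cong (ℤ._+_ (coeff p 0)) (ℤₚ.*-zeroʳ y)) (ℤₚ.+-identityʳ _))
  reverseEval-shift (suc D) p q q0 qs =
    cong₂ (λ u v → u ℤ.+ y ℤ.* v) (qs (suc D)) (reverseEval-shift D p q q0 qs)

  reverseEval-⊗-xPow : ∀ p D e → reverseEval (e + D) (p ⊗ xPow e) ≡ reverseEval D p
  reverseEval-⊗-xPow p D zero = reverseEval-cong D (p ⊗ one) p (coeff-⊗-one p)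
  reverseEval-⊗-xPow p D (suc e) = trans
    (reverseEval-shift (e + D) (p ⊗ xPow e) (p ⊗ xPow (suc e))
      (coeff-⊗-xPow-zero p e) (coeff-⊗-xPow-suc p e))
    (reverseEval-⊗-xPow p D e)

  -- For degree at most D this is y^(D+1) (1 - 1/y) p(1/y) = (y - 1) y^D p(1/y). The extra summand
  -- is the coefficient just beyond that bound, which `reverseEval` at D does not see.
  reverseEval-oneMinusX : ∀ D p →
    reverseEval (suc D) (oneMinusX ⊗ p) ≡ coeff p (suc D) ℤ.+ (y - + 1) ℤ.* reverseEval D p
  reverseEval-oneMinusX zero p
    rewrite coeff-oneMinusX-suc p 0 | coeff-oneMinusX-zero p = arith (coeff p 1) (coeff p 0) y
    where
    arith : ∀ a b y → a - b ℤ.+ y ℤ.* b ≡ a ℤ.+ (y - + 1) ℤ.* b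
    arith = ℤ-Solver.solve-∀
  reverseEval-oneMinusX (suc D) p
    rewrite coeff-oneMinusX-suc p (suc D) | reverseEval-oneMinusX D p =
    arith (coeff p (2 + D)) (coeff p (suc D)) y (reverseEval D p)
    where
    arith : ∀ a b y u → a - b ℤ.+ y ℤ.* (b ℤ.+ (y - + 1) ℤ.* u)
      ≡ a ℤ.+ (y - + 1) ℤ.* (b ℤ.+ y ℤ.* u)
    arith = ℤ-Solver.solve-∀

reverseEval-pPow : ∀ z k → reverseEval (+ suc z) k (pPow oneMinusX k) ≡ + (z ^ k)
reverseEval-pPow z zero = refl
reverseEval-pPow z (suc k) = begin
  reverseEval (+ suc z) (suc k) (oneMinusX ⊗ pPow oneMinusX k)
    ≡⟨ reverseEval-oneMinusX (+ suc z) k (pPow oneMinusX k) ⟩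
  coeff (pPow oneMinusX k) (suc k) ℤ.+ + z ℤ.* reverseEval (+ suc z) k (pPow oneMinusX k)
    ≡⟨ cong₂ (λ u v → u ℤ.+ + z ℤ.* v) (coeff-pPow-degree k (suc k) (n<1+n k)) (reverseEval-pPow z k) ⟩
  + 0 ℤ.+ + z ℤ.* + (z ^ k)
    ≡⟨ trans (ℤₚ.+-identityˡ _) (sym (ℤₚ.pos-* z (z ^ k))) ⟩
  + (z ^ suc k) ∎
  where open ≡-Reasoning

reverseEval-psumBelow : ∀ z D n (c : ℕ → ℕ) → n ≤ D →
  reverseEval (+ suc z) D
    (psumBelow (suc n) (λ k → scale (+ c k) (pPow oneMinusX k ⊗ xPow (D ∸ k))))
    ≡ + sumTo n (λ k → c k * z ^ k)
reverseEval-psumBelow z D n c n≤D = go n n≤D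
  where
  open ≡-Reasoning
  y = + suc z
  P : ℕ → Poly
  P k = scale (+ c k) (pPow oneMinusX k ⊗ xPow (D ∸ k))
  summand : ∀ k → k ≤ D → reverseEval y D (P k) ≡ + (c k * z ^ k)
  summand k k≤D = begin
    reverseEval y D (P k)
      ≡⟨ reverseEval-scale y D (+ c k) (pPow oneMinusX k ⊗ xPow (D ∸ k)) ⟩
    + c k ℤ.* reverseEval y D (pPow oneMinusX k ⊗ xPow (D ∸ k))
      ≡⟨ cong (λ E → + c k ℤ.* reverseEval y E (pPow oneMinusX k ⊗ xPow (D ∸ k)))
              (sym (m∸n+n≡m k≤D)) ⟩
    + c k ℤ.* reverseEval y (D ∸ k + k) (pPow oneMinusX k ⊗ xPow (D ∸ k))
      ≡⟨ cong (ℤ._*_ (+ c k)) (trans (reverseEval-⊗-xPow y (pPow oneMinusX k) k (D ∸ k))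
                                  (reverseEval-pPow z k)) ⟩
    + c k ℤ.* + (z ^ k)
      ≡⟨ sym (ℤₚ.pos-* (c k) (z ^ k)) ⟩
    + (c k * z ^ k) ∎
  go : ∀ n → n ≤ D → reverseEval y D (psumBelow (suc n) P) ≡ + sumTo n (λ k → c k * z ^ k)
  go zero _ = summand 0 z≤n
  go (suc n) n<D = begin
    reverseEval y D (psumBelow (suc n) P ⊕ P (suc n))
      ≡⟨ reverseEval-⊕ y D (psumBelow (suc n) P) (P (suc n)) ⟩
    reverseEval y D (psumBelow (suc n) P) ℤ.+ reverseEval y D (P (suc n))
      ≡⟨ cong₂ ℤ._+_ (go n (<⇒≤ n<D)) (summand (suc n) n<D) ⟩
    + sumTo n (λ k → c k * z ^ k) ℤ.+ + (c (suc n) * z ^ suc n)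
      ≡⟨ sym (ℤₚ.pos-+ (sumTo n (λ k → c k * z ^ k)) _) ⟩
    + sumTo (suc n) (λ k → c k * z ^ k) ∎

-- Recovering coefficients from values

horner-injective : ∀ D a b → (∀ z → horner (+ suc z) D a ≡ horner (+ suc z) D b) →
  ∀ m → m ≤ D → a m ≡ b m
horner-injective zero a b eq zero _ = eq 0
horner-injective (suc D) a b eq = λ where
    zero _ → a₀≡b₀
    (suc m) (s≤s m≤D) → horner-injective D (a ∘ suc) (b ∘ suc) eq′ m m≤D
  where
  open ≡-Reasoning
  A B : ℕ → ℤ
  A z = horner (+ suc z) D (a ∘ suc)
  B z = horner (+ suc z) D (b ∘ suc)
  difference : ∀ z → a 0 - b 0 ≡ + suc z ℤ.* (B z - A z)
  difference z = begin
    a 0 - b 0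
      ≡⟨ arith₁ (a 0) (b 0) (+ suc z) (A z) ⟩
    (a 0 ℤ.+ + suc z ℤ.* A z) - (b 0 ℤ.+ + suc z ℤ.* A z)
      ≡⟨ cong (λ u → u - (b 0 ℤ.+ + suc z ℤ.* A z)) (eq z) ⟩
    (b 0 ℤ.+ + suc z ℤ.* B z) - (b 0 ℤ.+ + suc z ℤ.* A z)
      ≡⟨ arith₂ (b 0) (+ suc z) (A z) (B z) ⟩
    + suc z ℤ.* (B z - A z) ∎
    where
    arith₁ : ∀ a b y u → a - b ≡ (a ℤ.+ y ℤ.* u) - (b ℤ.+ y ℤ.* u)
    arith₁ = ℤ-Solver.solve-∀
    arith₂ : ∀ b y u v → (b ℤ.+ y ℤ.* v) - (b ℤ.+ y ℤ.* u) ≡ y ℤ.* (v - u)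
    arith₂ = ℤ-Solver.solve-∀
  -- a₀ − b₀ is divisible by every positive integer, in particular by one larger than |a₀ − b₀|.
  ∣difference∣≡0 : ∀ N k → N ≡ suc N * k → N ≡ 0
  ∣difference∣≡0 N zero N≡ = trans N≡ (*-zeroʳ (suc N))
  ∣difference∣≡0 N (suc k) N≡ = ⊥-elim (1+n≰n (≤-trans (m≤m*n (suc N) (suc k)) (≤-reflexive (sym N≡))))
  a₀≡b₀ : a 0 ≡ b 0
  a₀≡b₀ = ℤₚ.i-j≡0⇒i≡j (a 0) (b 0) (ℤₚ.∣i∣≡0⇒i≡0 (∣difference∣≡0 N ℤ.∣ B N - A N ∣
    (trans (cong ℤ.∣_∣ (difference N)) (ℤₚ.abs-* (+ suc N) (B N - A N)))))
    where N = ℤ.∣ a 0 - b 0 ∣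
  -- Once the constant terms agree, the nonzero factor y = 1 + z cancels, and the tails agree at the
  -- same values.
  eq′ : ∀ z → A z ≡ B z
  eq′ z = sym (ℤₚ.i-j≡0⇒i≡j (B z) (A z) (ℤₚ.*-cancelˡ-≡ (+ suc z) (B z - A z) (+ 0)
    (trans (sym (difference z)) (trans (ℤₚ.i≡j⇒i-j≡0 a₀≡b₀) (sym (ℤₚ.*-zeroʳ (+ suc z)))))))

horner-indicator : ∀ y D m₀ → m₀ ≤ D → horner (+ y) D (λ m → + (if m₀ ≡ᵇ m then 1 else 0)) ≡ + (y ^ m₀)
horner-indicator y zero zero _ = refl
horner-indicator y (suc D) zero _ = trans
  (cong (λ u → + 1 ℤ.+ + y ℤ.* u) (horner-zero (+ y) D))
  (cong (ℤ._+_ (+ 1)) (ℤₚ.*-zeroʳ (+ y)))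
horner-indicator y (suc D) (suc m₀) (s≤s m₀≤D) = trans (ℤₚ.+-identityˡ _)
  (trans (cong (ℤ._*_ (+ y)) (horner-indicator y D m₀ m₀≤D)) (sym (ℤₚ.pos-* y (y ^ m₀))))

-- Each object satisfying both conditions contributes the single monomial y^(f x); the bound D on
-- `f` ensures that none is cut off.
horner-countB : ∀ {A : Set} y D (P Q : A → Bool) (f : A → ℕ) → (∀ x → f x ≤ D) → ∀ xs →
  horner (+ y) D (λ m → + countB (λ x → P x ∧ Q x ∧ (f x ≡ᵇ m)) xs)
    ≡ + listSum (λ x → if P x ∧ Q x then y ^ f x else 0) xs
horner-countB y D P Q f f≤D [] = horner-zero (+ y) D
horner-countB y D P Q f f≤D (x ∷ xs) = begin
  horner (+ y) D (λ m → + countB (R m) (x ∷ xs))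
    ≡⟨ horner-cong (+ y) D (λ m _ → split (R m x) (countB (R m) xs)) ⟩
  horner (+ y) D (λ m → + (if R m x then 1 else 0) ℤ.+ + countB (R m) xs)
    ≡⟨ horner-+ (+ y) D (λ m → + (if R m x then 1 else 0)) (λ m → + countB (R m) xs) ⟩
  horner (+ y) D (λ m → + (if R m x then 1 else 0)) ℤ.+ horner (+ y) D (λ m → + countB (R m) xs)
    ≡⟨ cong₂ ℤ._+_ first (horner-countB y D P Q f f≤D xs) ⟩
  + (if P x ∧ Q x then y ^ f x else 0) ℤ.+ + listSum (λ x → if P x ∧ Q x then y ^ f x else 0) xs
    ≡⟨ sym (ℤₚ.pos-+ (if P x ∧ Q x then y ^ f x else 0) _) ⟩
  + listSum (λ x → if P x ∧ Q x then y ^ f x else 0) (x ∷ xs) ∎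
  where
  open ≡-Reasoning
  R : ℕ → _ → Bool
  R m x = P x ∧ Q x ∧ (f x ≡ᵇ m)
  split : ∀ p c → + (if p then suc c else c) ≡ + (if p then 1 else 0) ℤ.+ + c
  split true c = refl
  split false c = refl
  first : horner (+ y) D (λ m → + (if R m x then 1 else 0)) ≡ + (if P x ∧ Q x then y ^ f x else 0)
  first with P x | Q x
  ... | true | true = horner-indicator y D (f x) (f≤D x)
  ... | true | false = horner-zero (+ y) D
  ... | false | _ = horner-zero (+ y) D

countB≤length : ∀ {A : Set} (P : A → Bool) xs → countB P xs ≤ length xs
countB≤length P [] = z≤n
countB≤length P (x ∷ xs) with P x
... | true = s≤s (countB≤length P xs)
... | false = m≤n⇒m≤1+n (countB≤length P xs)

countB-none : ∀ {A : Set} (P : A → Bool) xs → (∀ x → P x ≡ false) → countB P xs ≡ 0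
countB-none P [] none = refl
countB-none P (x ∷ xs) none rewrite none x = countB-none P xs none

stat≤n : ∀ n i j b → stat n i j b ≤ n
stat≤n n i j b = ≤-trans (countB≤length (special (suc n) i j b) (range1 n))
  (≤-reflexive (trans (length-map suc (upTo n)) (length-upTo n)))

coeffℤ-≤ : ∀ p {d m} → m ≤ d → coeffℤ p (+ d - + m) ≡ coeff p (d ∸ m)
coeffℤ-≤ p {d} {m} m≤d = cong (coeffℤ p) (trans (ℤₚ.m-n≡m⊖n d m) (ℤₚ.⊖-≥ m≤d))

coeffℤ-> : ∀ p {d m} → d < m → coeffℤ p (+ d - + m) ≡ + 0
coeffℤ-> p {d} {m} d<m = trans (cong (coeffℤ p) (trans (ℤₚ.m-n≡m⊖n d m) (ℤₚ.⊖-< d<m)))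
  (negative (m ∸ d) (λ eq → <⇒≱ d<m (m∸n≡0⇒m≤n eq)))
  where
  negative : ∀ k → k ≢ 0 → coeffℤ p (ℤ.- (+ k)) ≡ + 0
  negative zero k≢0 = ⊥-elim (k≢0 refl)
  negative (suc k) _ = refl

-- Both coefficient families have the same value at every y = 1 + z. Index m of `reverseEval` at D =
-- d belongs to the exponent d - m, so the reversal is already the one in the claim.
fpoly-coeff : ∀ n i j → (i ≡ 0 × j ≡ 0) ⊎ (1 ≤ i × i + j ≤ n) →
  ∀ m → m ≤ suc n → coeff (fpoly (suc n) i j) (suc n ∸ m) ≡ + countNC (suc n) i j m
fpoly-coeff n i j ij = horner-injective (suc n) _ _ λ z → begin
  reverseEval (+ suc z) (suc n) (fpoly (suc n) i j)
    ≡⟨ reverseEval-psumBelow z (suc n) n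
         (λ k → catalan (n ∸ k) * innerSum (suc n) i j k) (n≤1+n n) ⟩
  + sumTo n (λ k → catalan (n ∸ k) * innerSum (suc n) i j k * z ^ k)
    ≡⟨ cong +_ (closed-innerSum z n i j) ⟩
  + closed z n i j
    ≡⟨ cong +_ (sym (statWeight-sum z n i j ij)) ⟩
  + listSum (statWeight n i j z) (lists n n)
    ≡⟨ sym (horner-countB (suc z) (suc n) (isPartition n) (isNoncrossing n) (stat n i j)
         (λ b → m≤n⇒m≤1+n (stat≤n n i j b)) (lists n n)) ⟩
  horner (+ suc z) (suc n) (λ m → + countNC (suc n) i j m) ∎
  where open ≡-Reasoning

theorem5p5 : (d i j : ℕ) → 2 ≤ d → j < d ∸ 1
    → ((i ≡ 0 × j ≡ 0) ⊎ (1 ≤ i × i + j ≤ d ∸ 1))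
    → (m : ℕ) → coeffℤ (fpoly d i j) (+ d - + m) ≡ + countNC d i j m
theorem5p5 (suc n) i j _ _ ij m with m ≤? suc n
... | yes m≤d = trans (coeffℤ-≤ (fpoly (suc n) i j) m≤d) (fpoly-coeff n i j ij m m≤d)
-- Here d - m is negative, where `coeffℤ` is 0 by convention, and no partition has more than n < m
-- special elements.
... | no m≰d = trans (coeffℤ-> (fpoly (suc n) i j) (≰⇒> m≰d))
  (cong +_ (sym (countB-none _ (lists n n) none)))
  where
  none : ∀ b → isPartition n b ∧ isNoncrossing n b ∧ (stat n i j b ≡ᵇ m) ≡ false
  none b rewrite dec-false (stat n i j b ≟ m)
      (λ { refl → m≰d (m≤n⇒m≤1+n (stat≤n n i j b)) })
    | ∧-zeroʳ (isNoncrossing n b) = ∧-zeroʳ (isPartition n b)
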